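{- Let $d>0$ be a real number and let $G$ be a graph such that $\lVert H\rVert\le d|H|$ for every subgraph $H$ of $G$ (in particular for every bipartite subgraph). If $\Delta(G)\ge 6.21d$, then $G$ has an equitable $r$-coloring for every integer $r\ge\Delta(G)$.
   Context: All graphs are finite and simple. For a graph $H$, $|H|$ denotes its number of vertices and $\lVert H\rVert$ its number of edges; $\Delta(G)$ is the maximum degree. The class of such graphs $G$ is denoted $\mathcal{G}_d$ in the paper. An equitable $r$-coloring of $G$ is a partition of $V(G)$ into $r$ independent sets whose sizes pairwise differ by at most one. -}

module Defs where

open import Data.Nat using (ℕ; _+_; _*_; _≤_; _<ᵇ_; _⊔_)
open import Data.Bool using (Bool; true; false; if_then_else_; _∧_)
open import Data.Fin using (Fin; toℕ)
open import Data.Fin.Properties using (_≟_)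
open import Data.List using (List; map; foldr)
open import Data.Nat.ListAction using (sum)
open import Data.List.Base using (allFin)
open import Data.Product using (_×_)
open import Data.Empty using (⊥)
open import Relation.Nullary.Decidable using (⌊_⌋)
open import Relation.Binary.PropositionalEquality using (_≡_)

record Graph (n : ℕ) : Set where
  field
    adj    : Fin n → Fin n → Bool
    sym    : ∀ i j → adj i j ≡ adj j i
    irrefl : ∀ i → adj i i ≡ false
open Graph public

count : {n : ℕ} → (Fin n → Bool) → ℕ
count {n} P = sum (map (λ i → if P i then 1 else 0) (allFin n))

degree : {n : ℕ} → Graph n → Fin n → ℕ
degree G v = count (adj G v)

-- maximum degree Δ(G) (0 for the empty graph)
maxDegree : {n : ℕ} → Graph n → ℕ
maxDegree {n} G = foldr _⊔_ 0 (map (degree G) (allFin n))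

record Subgraph {n : ℕ} (G : Graph n) : Set where
  field
    verts   : Fin n → Bool
    edges   : Fin n → Fin n → Bool
    esym    : ∀ i j → edges i j ≡ edges j i
    sub     : ∀ i j → edges i j ≡ true →
              (adj G i j ≡ true) × (verts i ≡ true) × (verts j ≡ true)
open Subgraph public

∣_∣ᵥ : {n : ℕ} {G : Graph n} → Subgraph G → ℕ
∣ H ∣ᵥ = count (verts H)

-- ‖H‖ : number of edges (unordered pairs {i,j}, counted with i < j)
‖_‖ₑ : {n : ℕ} {G : Graph n} → Subgraph G → ℕ
‖_‖ₑ {n} H = sum (map (λ i → count (λ j → edges H i j ∧ (toℕ i <ᵇ toℕ j))) (allFin n))

record EquitableColoring {n : ℕ} (G : Graph n) (r : ℕ) : Set where
  field
    color  : Fin n → Fin r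
    proper : ∀ u v → adj G u v ≡ true → color u ≡ color v → ⊥
    equit  : ∀ a b → count (λ v → ⌊ color v ≟ a ⌋) ≤ count (λ v → ⌊ color v ≟ b ⌋) + 1

{-# OPTIONS --safe #-}
-- Let d = p / q.  Colour the vertices one at a time, in an order in which each new vertex x has at
-- most 2d coloured neighbours, keeping all class sizes in {t, t + 1}.  Write X → V if some vertex of
-- X has no neighbour in V.  If x has no neighbour in a class from which a class of size t can be
-- reached, shift one vertex along each arc of a path and insert x.  Otherwise a maximal family of
-- such accessible classes has at most 2d members, and each vertex outside it has a neighbour in each
-- of its classes.  Let K be a component of the graph whose edges are the pairs with arcs both ways;
-- since two non-adjacent classes (not both accessible) span at least t + 1 edges, sparsity yields a
-- K with g > r / 2 members and c g ≤ d r, where c = r − g.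
--
-- Let W be the last class added to the accessible family.  Double counting gives w ∈ W for which the
-- neighbours of w in K plus the solo ones (those y for which w is the only neighbour in W) number at
-- least 2g.  If w can move to another accessible class, replacing it by a solo y makes all of K
-- accessible.  If y, z are non-adjacent solo neighbours, and w can take the place of y in K (because
-- w has a single neighbour in the class of y, or no neighbour in some class of K), then exchanging
-- w and y makes the class of z accessible.  In both cases the accessible family grows.  If neither
-- is possible, then at least g − 3c of the at least g − c solo neighbours are adjacent to all
-- others, which contradicts sparsity when 6.21 d ≤ r.
module Submission where

open import Defs
open import Data.Bool using (Bool; true; false; if_then_else_; _∧_; _∨_; not; T)
open import Data.Bool.Properties using (∧-comm; ∧-identityʳ; ∧-zeroʳ)
open import Data.Empty using (⊥; ⊥-elim)
open import Data.Fin using (Fin; zero; suc; toℕ)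
open import Data.Fin.Properties using (_≟_; any?; all?; toℕ-injective)
open import Data.List using (List; []; _∷_; map; length; allFin; tabulate)
open import Data.List.Properties using (map-tabulate)
open import Data.List.Membership.Propositional using (_∈_; _∉_)
import Data.List.Membership.DecPropositional as DecMembership
open import Data.List.Membership.Propositional.Properties using (∈-allFin)
open import Data.List.Relation.Unary.Any using (here; there)
open import Data.Maybe using (Maybe; just; nothing; is-just; maybe′)
open import Data.Maybe.Properties using (≡-dec; just-injective)
import Data.Nat.ListAction as ListAction
open import Data.Nat using (ℕ; zero; suc; _+_; _*_; _≤_; _<_; _≤?_; _≡ᵇ_; _<ᵇ_; z≤n; s≤s; _⊔_; NonZero; >-nonZero; pred)
open import Data.Nat.Properties hiding (_≟_)
open import Relation.Binary.Definitions using (tri<; tri≈; tri>)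
open import Data.Nat.Tactic.RingSolver using (solve-∀)
open import Data.Product using (∃; _×_; _,_; proj₁; proj₂)
open import Data.Sum using (_⊎_; inj₁; inj₂)
open import Function using (_∘_; id)
open import Relation.Nullary using (¬_; Dec; yes; no; contradiction)
open import Relation.Nullary.Decidable using (⌊_⌋; ¬?; _×-dec_; _⊎-dec_; _→-dec_)
open import Relation.Binary.PropositionalEquality using (_≡_; _≢_; refl; trans; cong; cong₂; subst; subst₂; module ≡-Reasoning) renaming (sym to ≡-sym)

open import Algebra.Properties.Semiring.Sum +-*-semiring using (sum; sum-cong-≗; ∑-distrib-+; ∑-comm; *-distribˡ-sum; sum-replicate-zero)
open import Algebra.Properties.CommutativeSemigroup *-commutativeSemigroup using (x∙yz≈y∙xz)
open import Algebra.Properties.CommutativeSemigroup +-commutativeSemigroup using () renaming (x∙yz≈y∙xz to +-exchange)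

-- Indicators, finite sums and averaging

⟦_⟧ : Bool → ℕ
⟦ b ⟧ = if b then 1 else 0

true≢false : {b : Bool} → b ≡ true → b ≡ false → ⊥
true≢false refl ()

⟦⟧≤1 : ∀ b → ⟦ b ⟧ ≤ 1
⟦⟧≤1 true = ≤-refl
⟦⟧≤1 false = z≤n

⟦∧⟧ : ∀ a b → ⟦ a ∧ b ⟧ ≡ ⟦ a ⟧ * ⟦ b ⟧
⟦∧⟧ true b = ≡-sym (+-identityʳ _)
⟦∧⟧ false b = refl

⟦⟧+⟦not⟧ : ∀ b → ⟦ b ⟧ + ⟦ not b ⟧ ≡ 1
⟦⟧+⟦not⟧ true = refl
⟦⟧+⟦not⟧ false = refl

⟦⟧*-mono : ∀ b {x y} → (b ≡ true → x ≤ y) → ⟦ b ⟧ * x ≤ ⟦ b ⟧ * y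
⟦⟧*-mono true h = +-monoˡ-≤ 0 (h refl)
⟦⟧*-mono false h = z≤n

⟦⟧*-cong : ∀ b {x y} → (b ≡ true → x ≡ y) → ⟦ b ⟧ * x ≡ ⟦ b ⟧ * y
⟦⟧*-cong true h = cong (_+ 0) (h refl)
⟦⟧*-cong false h = refl

-- Sealed so that later goals keep `∑` folded; the lemmas of this block are the only access to its
-- recursion.
opaque
  ∑ : ∀ {n} → (Fin n → ℕ) → ℕ
  ∑ = sum

  ∑-cong : ∀ {n} {f g : Fin n → ℕ} → (∀ i → f i ≡ g i) → ∑ f ≡ ∑ g
  ∑-cong = sum-cong-≗

  ∑-+ : ∀ {n} (f g : Fin n → ℕ) → ∑ (λ i → f i + g i) ≡ ∑ f + ∑ g
  ∑-+ = ∑-distrib-+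

  ∑-swap : ∀ {m n} (f : Fin m → Fin n → ℕ) → ∑ (λ i → ∑ (f i)) ≡ ∑ (λ j → ∑ (λ i → f i j))
  ∑-swap = ∑-comm

  *-∑ : ∀ {n} k (f : Fin n → ℕ) → k * ∑ f ≡ ∑ (λ i → k * f i)
  *-∑ = *-distribˡ-sum

  ∑-mono : ∀ {n} {f g : Fin n → ℕ} → (∀ i → f i ≤ g i) → ∑ f ≤ ∑ g
  ∑-mono {zero} h = z≤n
  ∑-mono {suc n} h = +-mono-≤ (h zero) (∑-mono (h ∘ suc))

  term≤∑ : ∀ {n} (f : Fin n → ℕ) i → f i ≤ ∑ f
  term≤∑ f zero = m≤m+n _ _
  term≤∑ f (suc i) = ≤-trans (term≤∑ (f ∘ suc) i) (m≤n+m _ _)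

  ∑-zero : ∀ {n} {f : Fin n → ℕ} → (∀ i → f i ≡ 0) → ∑ f ≡ 0
  ∑-zero {n} h = trans (∑-cong h) (sum-replicate-zero n)

  ∑-const : ∀ n k → ∑ {n} (λ _ → k) ≡ n * k
  ∑-const zero k = refl
  ∑-const (suc n) k = cong (k +_) (∑-const n k)

  -- Crosswise addition replaces subtraction of the term at `u`, so one identity serves both for
  -- removing and for adding a term.
  ∑-update : ∀ {n} {f g : Fin n → ℕ} u → (∀ i → i ≢ u → f i ≡ g i) → g u + ∑ f ≡ f u + ∑ g
  ∑-update {suc n} {f} {g} zero h =
    trans (cong (λ k → g zero + (f zero + k)) (∑-cong (λ i → h (suc i) λ ())))
          (+-exchange (g zero) (f zero) _)
  ∑-update {suc n} {f} {g} (suc u) h = begin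
    g (suc u) + (f zero + ∑ (f ∘ suc)) ≡⟨ +-exchange (g (suc u)) (f zero) _ ⟩
    f zero + (g (suc u) + ∑ (f ∘ suc)) ≡⟨ cong₂ _+_ (h zero λ ()) (∑-update u λ i i≢u → h (suc i) λ { refl → i≢u refl }) ⟩
    g zero + (f (suc u) + ∑ (g ∘ suc)) ≡⟨ +-exchange (g zero) (f (suc u)) _ ⟩
    f (suc u) + (g zero + ∑ (g ∘ suc)) ∎
    where open ≡-Reasoning

  sumList≡∑ : ∀ {n} (f : Fin n → ℕ) → ListAction.sum (map f (allFin n)) ≡ ∑ f
  sumList≡∑ {n} f = trans (cong ListAction.sum (map-tabulate id f)) (go n f)
    where
    go : ∀ n (f : Fin n → ℕ) → ListAction.sum (tabulate f) ≡ ∑ f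
    go zero f = refl
    go (suc n) f = cong (f zero +_) (go n (f ∘ suc))

∑-point : ∀ {n} (f : Fin n → ℕ) u → (∀ i → i ≢ u → f i ≡ 0) → ∑ f ≡ f u
∑-point {n} f u h = begin
  ∑ f                  ≡⟨ ∑-update u h ⟩
  f u + ∑ {n} (λ _ → 0) ≡⟨ cong (f u +_) (∑-zero {n} λ _ → refl) ⟩
  f u + 0                ≡⟨ +-identityʳ _ ⟩
  f u                    ∎
  where open ≡-Reasoning

count≡∑ : ∀ {n} (P : Fin n → Bool) → count P ≡ ∑ (⟦_⟧ ∘ P)
count≡∑ P = sumList≡∑ (⟦_⟧ ∘ P)

-- Averaging: if `g` were at least `suc m` on all of `P`, the sum would be too large. Strictness
-- also forces `P` to be non-empty.
∃-light : ∀ {n} (P : Fin n → Bool) (g : Fin n → ℕ) m →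
  ∑ (λ i → ⟦ P i ⟧ * g i) < suc m * ∑ (⟦_⟧ ∘ P) → ∃ λ i → P i ≡ true × g i ≤ m
∃-light P g m h with any? (λ i → (P i Data.Bool.≟ true) ×-dec (g i ≤? m))
... | yes p = p
... | no ¬p = contradiction h (≤⇒≯ (begin
  suc m * ∑ (⟦_⟧ ∘ P)           ≡⟨ *-∑ (suc m) (⟦_⟧ ∘ P) ⟩
  ∑ (λ i → suc m * ⟦ P i ⟧)     ≤⟨ ∑-mono (λ i → ≤-trans (≤-reflexive (*-comm (suc m) ⟦ P i ⟧)) (⟦⟧*-mono (P i) λ e → ≰⇒> λ l → ¬p (i , e , l))) ⟩
  ∑ (λ i → ⟦ P i ⟧ * g i)       ∎))
  where open ≤-Reasoning

-- Averaging in the other direction; the comparison of sums is not strict here, so non-emptiness of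
-- `P` is assumed separately.
∃-heavy : ∀ {n} (P : Fin n → Bool) (g : Fin n → ℕ) m →
  m * ∑ (⟦_⟧ ∘ P) ≤ ∑ (λ i → ⟦ P i ⟧ * g i) → 0 < ∑ (⟦_⟧ ∘ P) → ∃ λ i → P i ≡ true × m ≤ g i
∃-heavy P g m h pos with any? (λ i → (P i Data.Bool.≟ true) ×-dec (m ≤? g i))
... | yes p = p
... | no ¬p = contradiction h (<⇒≱ (begin-strict
  ∑ (λ i → ⟦ P i ⟧ * g i)                    <⟨ m<m+n _ pos ⟩
  ∑ (λ i → ⟦ P i ⟧ * g i) + ∑ (⟦_⟧ ∘ P)    ≡⟨ ∑-+ (λ i → ⟦ P i ⟧ * g i) (⟦_⟧ ∘ P) ⟨
  ∑ (λ i → ⟦ P i ⟧ * g i + ⟦ P i ⟧)          ≤⟨ ∑-mono (λ i → ≤-trans (≤-reflexive (lem ⟦ P i ⟧ (g i))) (≤-trans (⟦⟧*-mono (P i) λ e → ≰⇒> λ l → ¬p (i , e , l)) (≤-reflexive (*-comm ⟦ P i ⟧ m)))) ⟩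
  ∑ (λ i → m * ⟦ P i ⟧)                      ≡⟨ *-∑ m (⟦_⟧ ∘ P) ⟨
  m * ∑ (⟦_⟧ ∘ P)                            ∎))
  where
  open ≤-Reasoning
  lem : ∀ a b → a * b + a ≡ a * suc b
  lem = solve-∀

∑-pos : ∀ {n} (P : Fin n → Bool) i → P i ≡ true → 0 < ∑ (⟦_⟧ ∘ P)
∑-pos P i e = ≤-trans (≤-reflexive (cong ⟦_⟧ (≡-sym e))) (term≤∑ (⟦_⟧ ∘ P) i)

≟-refl : ∀ {n} (i : Fin n) → ⌊ i ≟ i ⌋ ≡ true
≟-refl i with i ≟ i
... | yes _ = refl
... | no i≢i = contradiction refl i≢i

≟-false : ∀ {n} {i j : Fin n} → i ≢ j → ⌊ i ≟ j ⌋ ≡ false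
≟-false {i = i} {j} i≢j with i ≟ j
... | yes p = contradiction p i≢j
... | no _ = refl

≡false : {b : Bool} → ¬ (b ≡ true) → b ≡ false
≡false {true} h = contradiction refl h
≡false {false} h = refl

¬false⇒true : {b : Bool} → ¬ (b ≡ false) → b ≡ true
¬false⇒true {true} h = refl
¬false⇒true {false} h = contradiction refl h

∧-true : ∀ {a b} → a ∧ b ≡ true → a ≡ true × b ≡ true
∧-true {true} {true} e = refl , refl

<ᵇ-true : ∀ {m n} → m < n → (m <ᵇ n) ≡ true
<ᵇ-true {m} {n} l with m <ᵇ n in eq
... | true = refl
... | false = ⊥-elim (subst T eq (<⇒<ᵇ l))

<ᵇ-false : ∀ {m n} → n ≤ m → (m <ᵇ n) ≡ false
<ᵇ-false {m} {n} l = ≡false λ e → <⇒≱ (<ᵇ⇒< m n (subst T (≡-sym e) _)) l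

-- Degree sums and sparsity

module Sparse {n : ℕ} (G : Graph n) where

  α : Fin n → Fin n → ℕ
  α u v = ⟦ adj G u v ⟧

  α-sym : ∀ u v → α u v ≡ α v u
  α-sym u v = cong ⟦_⟧ (sym G u v)

  degree≤maxDegree : ∀ v → degree G v ≤ maxDegree G
  degree≤maxDegree v = go (allFin n) (∈-allFin v)
    where
    go : ∀ L → v ∈ L → degree G v ≤ Data.List.foldr _⊔_ 0 (map (degree G) L)
    go (u ∷ L) (here refl) = m≤m⊔n _ _
    go (u ∷ L) (there v∈L) = ≤-trans (go L v∈L) (m≤n⊔m _ _)

  induced : (Fin n → Bool) → Subgraph G
  induced P = record
    { verts = P
    ; edges = λ i j → (P i ∧ P j) ∧ adj G i j
    ; esym = λ i j → cong₂ _∧_ (∧-comm (P i) (P j)) (sym G i j)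
    ; sub = λ i j e → let (e₁ , e₂) = ∧-true {P i ∧ P j} e ; (e₃ , e₄) = ∧-true {P i} e₁ in e₂ , e₃ , e₄
    }

  degIn : (Fin n → Bool) → Fin n → ℕ
  degIn P u = ∑ (λ v → ⟦ P v ⟧ * α u v)

  degIn≤degree : ∀ P u → degIn P u ≤ degree G u
  degIn≤degree P u = ≤-trans
    (∑-mono λ v → ≤-trans (*-monoˡ-≤ (α u v) (⟦⟧≤1 (P v))) (≤-reflexive (*-identityˡ _)))
    (≤-reflexive (≡-sym (count≡∑ (adj G u))))

  -- `up i j` counts an edge from its end of smaller index. Every ordered adjacent pair falls under
  -- `up i j` or `up j i`, and the diagonal vanishes by `irrefl`.
  handshake : ∀ P → ∑ (λ u → ⟦ P u ⟧ * degIn P u) ≡ 2 * ‖ induced P ‖ₑ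
  handshake P = begin
    ∑ (λ i → ⟦ P i ⟧ * degIn P i)
      ≡⟨ ∑-cong (λ i → trans (*-∑ ⟦ P i ⟧ _) (trans (∑-cong (λ j → split i j)) (∑-+ (up i) (λ j → up j i)))) ⟩
    ∑ (λ i → ∑ (up i) + ∑ (λ j → up j i))
      ≡⟨ ∑-+ (λ i → ∑ (up i)) (λ i → ∑ (λ j → up j i)) ⟩
    ∑ (λ i → ∑ (up i)) + ∑ (λ i → ∑ (λ j → up j i))
      ≡⟨ cong (∑ (λ i → ∑ (up i)) +_) (∑-swap (λ i j → up j i)) ⟩
    ∑ (λ i → ∑ (up i)) + ∑ (λ i → ∑ (up i))
      ≡⟨ cong (λ k → k + k) (trans (∑-cong (λ i → ≡-sym (count≡∑ _))) (≡-sym (sumList≡∑ (λ i → count (λ j → ((P i ∧ P j) ∧ adj G i j) ∧ (toℕ i <ᵇ toℕ j)))))) ⟩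
    ‖ induced P ‖ₑ + ‖ induced P ‖ₑ
      ≡⟨ cong (‖ induced P ‖ₑ +_) (≡-sym (+-identityʳ _)) ⟩
    2 * ‖ induced P ‖ₑ ∎
    where
    open ≡-Reasoning
    e : Fin n → Fin n → Bool
    e i j = (P i ∧ P j) ∧ adj G i j
    up : Fin n → Fin n → ℕ
    up i j = ⟦ e i j ∧ (toℕ i <ᵇ toℕ j) ⟧
    prod : ∀ i j → ⟦ P i ⟧ * (⟦ P j ⟧ * α i j) ≡ ⟦ e i j ⟧
    prod i j = trans (≡-sym (*-assoc ⟦ P i ⟧ ⟦ P j ⟧ (α i j)))
      (trans (cong (_* α i j) (≡-sym (⟦∧⟧ (P i) (P j)))) (≡-sym (⟦∧⟧ (P i ∧ P j) (adj G i j))))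
    split : ∀ i j → ⟦ P i ⟧ * (⟦ P j ⟧ * α i j) ≡ up i j + up j i
    split i j with <-cmp (toℕ i) (toℕ j)
    ... | tri< l _ _ rewrite <ᵇ-true l | <ᵇ-false (<⇒≤ l) | ∧-identityʳ (e i j) | ∧-zeroʳ (e j i) =
      trans (prod i j) (≡-sym (+-identityʳ _))
    ... | tri> _ _ l rewrite <ᵇ-true l | <ᵇ-false (<⇒≤ l) | ∧-identityʳ (e j i) | ∧-zeroʳ (e i j) =
      trans (prod i j) (cong ⟦_⟧ (esym (induced P) i j))
    ... | tri≈ _ i≡j _ rewrite toℕ-injective i≡j | irrefl G j | ∧-zeroʳ (P j ∧ P j) =
      trans (cong (⟦ P j ⟧ *_) (*-zeroʳ ⟦ P j ⟧)) (*-zeroʳ ⟦ P j ⟧)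

  module _ {p q : ℕ} (sparse : (H : Subgraph G) → q * ‖ H ‖ₑ ≤ p * ∣ H ∣ᵥ) where

    degreeSum≤ : ∀ P → q * ∑ (λ u → ⟦ P u ⟧ * degIn P u) ≤ 2 * p * ∑ (⟦_⟧ ∘ P)
    degreeSum≤ P = begin
      q * ∑ (λ u → ⟦ P u ⟧ * degIn P u)   ≡⟨ cong (q *_) (handshake P) ⟩
      q * (2 * ‖ induced P ‖ₑ)            ≡⟨ lem q _ ⟩
      2 * (q * ‖ induced P ‖ₑ)            ≤⟨ *-monoʳ-≤ 2 (sparse (induced P)) ⟩
      2 * (p * count P)                   ≡⟨ *-assoc 2 p _ ⟨
      2 * p * count P                     ≡⟨ cong (2 * p *_) (count≡∑ P) ⟩
      2 * p * ∑ (⟦_⟧ ∘ P) ∎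
      where
      open ≤-Reasoning
      lem : ∀ a b → a * (2 * b) ≡ 2 * (a * b)
      lem = solve-∀

    -- The average degree is at most `2d`, with `d = p / q` cleared of denominators. Iterated, this
    -- yields the order in which vertices are coloured.
    ∃-lowDegree : ∀ P → 0 < ∑ (⟦_⟧ ∘ P) → ∃ λ x → P x ≡ true × q * degIn P x ≤ 2 * p
    ∃-lowDegree P pos = ∃-light P (λ u → q * degIn P u) (2 * p) (begin-strict
      ∑ (λ u → ⟦ P u ⟧ * (q * degIn P u))    ≡⟨ ∑-cong (λ u → x∙yz≈y∙xz ⟦ P u ⟧ q (degIn P u)) ⟩
      ∑ (λ u → q * (⟦ P u ⟧ * degIn P u))    ≡⟨ *-∑ q _ ⟨
      q * ∑ (λ u → ⟦ P u ⟧ * degIn P u)      ≤⟨ degreeSum≤ P ⟩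
      2 * p * ∑ (⟦_⟧ ∘ P)                    <⟨ m<n+m _ pos ⟩
      suc (2 * p) * ∑ (⟦_⟧ ∘ P) ∎)
      where open ≤-Reasoning

-- The numerical constants are kept as variables tied by equations, since large numerals in
-- front of open terms would be unfolded by the conversion checker.

module Ratio {A h N c g : ℕ} (N≡ : N ≡ A + 2 * h) (0<g : 0 < g) (cg≤ : N * (c * g) ≤ h * ((c + g) * (c + g))) where

  -- The mixed term of `(c + g)²` absorbs the summand `2 * h` of `N`.
  cg≤c²+g² : A * (c * g) ≤ h * (c * c) + h * (g * g)
  cg≤c²+g² = +-cancelˡ-≤ (2 * h * (c * g)) _ _ (begin
    2 * h * (c * g) + A * (c * g)                 ≡⟨ *-distribʳ-+ (c * g) (2 * h) A ⟨
    (2 * h + A) * (c * g)                         ≡⟨ cong (_* (c * g)) (trans (+-comm (2 * h) A) (≡-sym N≡)) ⟩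
    N * (c * g)                                   ≤⟨ cg≤ ⟩
    h * ((c + g) * (c + g))                       ≡⟨ lem h c g ⟩
    2 * h * (c * g) + (h * (c * c) + h * (g * g)) ∎)
    where
    open ≤-Reasoning
    lem : ∀ h c g → h * ((c + g) * (c + g)) ≡ 2 * h * (c * g) + (h * (c * c) + h * (g * g))
    lem = solve-∀

  -- A bound c ≤ (k / m) g, fed back into A c g ≤ h c² + h g², gives c ≤ (h m / (A m − h k)) g.
  bootstrap : ∀ m k b m′ k′ .{{_ : NonZero b}} → A * m ≡ h * k + b → m′ * (h * m) ≤ b * k′ →
    m * c ≤ k * g → m′ * c ≤ k′ * g
  bootstrap m k b m′ k′ eq le bound = *-cancelˡ-≤ b (begin
    b * (m′ * c)        ≡⟨ x∙yz≈y∙xz b m′ c ⟩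
    m′ * (b * c)        ≤⟨ *-monoʳ-≤ m′ step ⟩
    m′ * (h * m * g)    ≡⟨ *-assoc m′ (h * m) g ⟨
    m′ * (h * m) * g    ≤⟨ *-monoˡ-≤ g le ⟩
    b * k′ * g          ≡⟨ *-assoc b k′ g ⟩
    b * (k′ * g)        ∎)
    where
    open ≤-Reasoning
    instance
      _ : NonZero g
      _ = >-nonZero 0<g
    lem₁ : ∀ h k b c g → h * c * (k * g) + b * c * g ≡ (h * k + b) * (c * g)
    lem₁ = solve-∀
    lem₂ : ∀ A m c g → A * m * (c * g) ≡ m * (A * (c * g))
    lem₂ = solve-∀
    lem₃ : ∀ h m c g → m * (h * (c * c) + h * (g * g)) ≡ h * c * (m * c) + h * m * g * g
    lem₃ = solve-∀
    step : b * c ≤ h * m * g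
    step = *-cancelʳ-≤ _ _ g (+-cancelˡ-≤ (h * c * (k * g)) _ _ (begin
      h * c * (k * g) + b * c * g         ≡⟨ lem₁ h k b c g ⟩
      (h * k + b) * (c * g)               ≡⟨ cong (_* (c * g)) eq ⟨
      A * m * (c * g)                     ≡⟨ lem₂ A m c g ⟩
      m * (A * (c * g))                   ≤⟨ *-monoʳ-≤ m cg≤c²+g² ⟩
      m * (h * (c * c) + h * (g * g))     ≡⟨ lem₃ h m c g ⟩
      h * c * (m * c) + h * m * g * g     ≤⟨ +-monoˡ-≤ _ (*-monoʳ-≤ (h * c) bound) ⟩
      h * c * (k * g) + h * m * g * g     ∎))

-- `S`, `Y` and `e` will be the sizes of the solo neighbourhood, of its dominating part and of the
-- rest. Write `g = 3c + y`, `Y = y + η`, `S = 2c + y + σ`. For fixed `S` the left side of the last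
-- bound is least at `η = 0`, and there `2Bc ≤ Ay`, which is what the value of `M` encodes, makes it
-- exceed the right side.
density-contradiction : ∀ {A B N M c g Y S e} → N ≡ A + B → M ≡ 3 * A + 2 * B → 0 < A →
  M * c ≤ A * g → 1 ≤ c → S ≡ Y + e → g ≤ Y + 3 * c → g ≤ S + c →
  N * (suc Y * (S + e)) ≤ B * ((c + g) * suc S) → ⊥
density-contradiction {A} {B} {N} {M} {c} {g} {Y} {S} {e} refl refl 0<A large 1≤c S≡Y+e g≤Y+3c g≤S+c bound
  with m≤n⇒∃[o]m+o≡n 3c≤g
  where
  open ≤-Reasoning
  instance
    _ : NonZero A
    _ = >-nonZero 0<A
  lem : ∀ A c → A * (3 * c) ≡ 3 * A * c
  lem = solve-∀
  3c≤g : 3 * c ≤ g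
  3c≤g = *-cancelˡ-≤ A (begin
    A * (3 * c)             ≡⟨ lem A c ⟩
    3 * A * c               ≤⟨ *-monoˡ-≤ c (m≤m+n (3 * A) (2 * B)) ⟩
    (3 * A + 2 * B) * c     ≤⟨ large ⟩
    A * g                   ∎)
... | y , refl
  with m≤n⇒∃[o]m+o≡n (+-cancelˡ-≤ (3 * c) y Y (≤-trans g≤Y+3c (≤-reflexive (+-comm Y _))))
     | m≤n⇒∃[o]m+o≡n {2 * c + y} {S} (+-cancelʳ-≤ c _ _ (≤-trans (≤-reflexive (lem c y)) g≤S+c))
  where
  lem : ∀ c y → 2 * c + y + c ≡ 3 * c + y
  lem = solve-∀
... | η , refl | σ , refl = <⇒≱ exceeds bound
  where
  open ≤-Reasoning
  2Bc≤Ay : 2 * B * c ≤ A * y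
  2Bc≤Ay = +-cancelˡ-≤ (3 * A * c) _ _ (begin
    3 * A * c + 2 * B * c ≡⟨ *-distribʳ-+ c (3 * A) (2 * B) ⟨
    (3 * A + 2 * B) * c   ≤⟨ large ⟩
    A * (3 * c + y)       ≡⟨ lem A c y ⟩
    3 * A * c + A * y     ∎)
    where
    lem : ∀ A c y → A * (3 * c + y) ≡ 3 * A * c + A * y
    lem = solve-∀

  r : ℕ
  r = 4 * c + y

  -- As `S + e = 2S - Y`, raising `Y` by `η` lowers `S + e` by `η` but adds `η` copies of it, and
  -- `S + e` is at least `suc y`.
  mono : suc y * (r + 2 * σ) ≤ suc (y + η) * (2 * c + y + σ + e)
  mono = begin
    suc y * (r + 2 * σ)                         ≡⟨ cong (suc y *_) split ⟩
    suc y * ((2 * c + y + σ + e) + η)           ≡⟨ *-distribˡ-+ (suc y) _ η ⟩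
    suc y * (2 * c + y + σ + e) + suc y * η     ≤⟨ +-monoʳ-≤ _ (≤-trans (≤-reflexive (*-comm (suc y) η)) (*-monoʳ-≤ η suc-y≤)) ⟩
    suc y * (2 * c + y + σ + e) + η * (2 * c + y + σ + e) ≡⟨ *-distribʳ-+ _ (suc y) η ⟨
    suc (y + η) * (2 * c + y + σ + e) ∎
    where
    lem₁ : ∀ c y σ → 4 * c + y + 2 * σ + y ≡ (2 * c + y + σ) + (2 * c + y + σ)
    lem₁ = solve-∀
    lem₂ : ∀ s y η e → s + (y + η + e) ≡ s + e + η + y
    lem₂ = solve-∀
    split : r + 2 * σ ≡ (2 * c + y + σ + e) + η
    split = +-cancelʳ-≡ y _ _ (trans (lem₁ c y σ) (trans (cong (2 * c + y + σ +_) S≡Y+e) (lem₂ (2 * c + y + σ) y η e)))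
    lem₃ : ∀ c y σ e → c + y + (c + (σ + e)) ≡ 2 * c + y + σ + e
    lem₃ = solve-∀
    suc-y≤ : suc y ≤ 2 * c + y + σ + e
    suc-y≤ = begin
      1 + y                   ≤⟨ +-monoˡ-≤ y 1≤c ⟩
      c + y                   ≤⟨ m≤m+n _ _ ⟩
      c + y + (c + (σ + e))   ≡⟨ lem₃ c y σ e ⟩
      2 * c + y + σ + e       ∎

  exceeds : B * ((c + (3 * c + y)) * suc (2 * c + y + σ)) < (A + B) * (suc (y + η) * (2 * c + y + σ + e))
  exceeds = begin-strict
    B * ((c + (3 * c + y)) * suc (2 * c + y + σ))
      ≡⟨ lem₁ B c y σ ⟩
    (2 * B * c + (B * y + B)) * r + σ * (2 * (2 * B * c) + B * y)
      ≤⟨ +-mono-≤ (*-monoˡ-≤ r (+-monoˡ-≤ _ 2Bc≤Ay)) (*-monoʳ-≤ σ (+-monoˡ-≤ (B * y) (*-monoʳ-≤ 2 2Bc≤Ay))) ⟩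
    (A * y + (B * y + B)) * r + σ * (2 * (A * y) + B * y)
      -- Strictness comes from the term `A * r` of the slack, positive because `A` and `c` are.
      <⟨ m<m+n _ (≤-trans (*-mono-≤ 0<A (≤-trans 1≤c (≤-trans (m≤m+n c _) (m≤m+n (4 * c) y)))) (m≤m+n (A * r) _)) ⟩
    (A * y + (B * y + B)) * r + σ * (2 * (A * y) + B * y) + (A * r + σ * (B * y + (2 * A + 2 * B)))
      ≡⟨ lem₂ A B r y σ ⟩
    (A + B) * (suc y * (r + 2 * σ))
      ≤⟨ *-monoʳ-≤ (A + B) mono ⟩
    (A + B) * (suc (y + η) * (2 * c + y + σ + e)) ∎
    where
    lem₁ : ∀ B c y σ → B * ((c + (3 * c + y)) * (1 + (2 * c + y + σ))) ≡
      (2 * B * c + (B * y + B)) * (4 * c + y) + σ * (2 * (2 * B * c) + B * y)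
    lem₁ = solve-∀
    lem₂ : ∀ A B r y σ → (A * y + (B * y + B)) * r + σ * (2 * (A * y) + B * y) + (A * r + σ * (B * y + (2 * A + 2 * B))) ≡
      (A + B) * ((1 + y) * (r + 2 * σ))
    lem₂ = solve-∀

-- N / h stands for the constant 6.21; A, M are the numbers that make `density-contradiction` applicable.
record Threshold (N h : ℕ) : Set where
  field
    {A M} : ℕ
    N≡    : N ≡ A + 2 * h
    M≡    : M ≡ 3 * A + 2 * (2 * h)
    0<A   : 0 < A
    6h<N  : h * 6 < N
    ratio : ∀ {c g} → 0 < g → c ≤ g → N * (c * g) ≤ h * ((c + g) * (c + g)) → M * c ≤ A * g

threshold : Threshold 621 100
threshold = record
  { A = 421
  ; M = 1663
  ; N≡ = refl
  ; M≡ = refl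
  ; 0<A = s≤s z≤n
  ; 6h<N = ≤ᵇ⇒≤ 601 621 _
  -- The bootstrap converges to the smaller root of `100 x² - 421 x + 100`, about 0.2527, just below
  -- the required 421 / 1663, about 0.2532. From `c ≤ g`, three rounds give the ratios 5 / 16, 100 /
  -- 389 and 421 / 1663, each rounded up.
  ; ratio = λ {c} {g} 0<g c≤g cg≤ →
      let open Ratio {421} {100} {621} {c} {g} refl 0<g cg≤ in
      bootstrap 389 100 153769 1663 421 refl (≤ᵇ⇒≤ _ _ _)
        (bootstrap 16 5 6236 389 100 refl (≤ᵇ⇒≤ _ _ _)
          (bootstrap 1 1 321 16 5 refl (≤ᵇ⇒≤ _ _ _) (*-monoʳ-≤ 1 c≤g)))
  }

-- Lists of classes grown along arcs

-- No element of a growth list depends on its head, so the head may be altered while the tail stays valid.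
data Growth {r : ℕ} (Root : Fin r → Set) (Arc : Fin r → Fin r → Set) : List (Fin r) → Set where
  []   : Growth Root Arc []
  grow : ∀ {V L} → V ∉ L → Root V ⊎ (∃ λ X → X ∈ L × Arc V X) → Growth Root Arc L → Growth Root Arc (V ∷ L)

Saturated : {r : ℕ} (Root : Fin r → Set) (Arc : Fin r → Fin r → Set) → List (Fin r) → Set
Saturated Root Arc L = ∀ V → V ∉ L → ¬ Root V × (∀ X → X ∈ L → ¬ Arc V X)

module _ {r : ℕ} where

  open DecMembership (_≟_ {r}) using (_∈?_)

  member : List (Fin r) → Fin r → Bool
  member L V = ⌊ V ∈? L ⌋

  member-∈ : ∀ {L V} → member L V ≡ true → V ∈ L
  member-∈ {L} {V} e with V ∈? L
  ... | yes V∈L = V∈L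

  ∈-member : ∀ {L V} → V ∈ L → member L V ≡ true
  ∈-member {L} {V} V∈L with V ∈? L
  ... | yes _ = refl
  ... | no V∉L = contradiction V∈L V∉L

  member-∉ : ∀ {L V} → member L V ≡ false → V ∉ L
  member-∉ e V∈L = true≢false (∈-member V∈L) e

  ∉-member : ∀ {L V} → V ∉ L → member L V ≡ false
  ∉-member V∉L = ≡false λ e → V∉L (member-∈ e)

  member-∷ : ∀ {U V L} → U ≢ V → member L U ≡ member (V ∷ L) U
  member-∷ {U} {V} {L} U≢V with member L U in eq
  ... | true = ≡-sym (∈-member {V ∷ L} (there (member-∈ eq)))
  ... | false = ≡-sym (∉-member {V ∷ L} λ { (here U≡V) → U≢V U≡V ; (there U∈L) → member-∉ eq U∈L })

  ∑-not : ∀ (M : Fin r → Bool) → ∑ (⟦_⟧ ∘ M) + ∑ (λ V → ⟦ not (M V) ⟧) ≡ r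
  ∑-not M = trans (≡-sym (∑-+ (⟦_⟧ ∘ M) (λ V → ⟦ not (M V) ⟧)))
    (trans (∑-cong (λ V → ⟦⟧+⟦not⟧ (M V))) (trans (∑-const r 1) (*-identityʳ r)))

  module _ {Root : Fin r → Set} {Arc : Fin r → Fin r → Set} where

    growth-length : ∀ {L} → Growth Root Arc L → ∑ (⟦_⟧ ∘ member L) ≡ length L
    growth-length [] = ∑-zero λ V → cong ⟦_⟧ (∉-member {[]} {V} λ ())
    growth-length {V ∷ L} (grow V∉L _ gr) = begin
      ∑ (⟦_⟧ ∘ member (V ∷ L))
        ≡⟨ cong (λ b → ⟦ b ⟧ + ∑ (⟦_⟧ ∘ member (V ∷ L))) (∉-member V∉L) ⟨
      ⟦ member L V ⟧ + ∑ (⟦_⟧ ∘ member (V ∷ L))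
        ≡⟨ ∑-update V (λ U U≢V → cong ⟦_⟧ (member-∷ U≢V)) ⟨
      ⟦ member (V ∷ L) V ⟧ + ∑ (⟦_⟧ ∘ member L)
        ≡⟨ cong₂ (λ b k → ⟦ b ⟧ + k) (∈-member {V ∷ L} (here refl)) (growth-length gr) ⟩
      suc (length L) ∎
      where open ≡-Reasoning

    growth-length≤ : ∀ {L} → Growth Root Arc L → length L ≤ r
    growth-length≤ {L} gr = begin
      length L               ≡⟨ growth-length gr ⟨
      ∑ (⟦_⟧ ∘ member L)     ≤⟨ m≤m+n _ _ ⟩
      _                      ≡⟨ ∑-not (member L) ⟩
      r                      ∎
      where open ≤-Reasoning

    -- Greedy extension. A growth list has no repetitions, hence at most `r` members, and `k` bounds
    -- the room left.
    saturate : (∀ V → Dec (Root V)) → (∀ V X → Dec (Arc V X)) →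
      ∀ {L} → Growth Root Arc L → ∃ λ L′ → Growth Root Arc L′ × Saturated Root Arc L′ × length L ≤ length L′
    saturate Root? Arc? = go r (m≤n+m r _)
      where
      extends? : ∀ L V → Dec (V ∉ L × (Root V ⊎ (∃ λ X → X ∈ L × Arc V X)))
      extends? L V = ¬? (V ∈? L) ×-dec (Root? V ⊎-dec any? (λ X → (X ∈? L) ×-dec Arc? V X))
      go : ∀ k {L} → r ≤ length L + k → Growth Root Arc L → ∃ λ L′ → Growth Root Arc L′ × Saturated Root Arc L′ × length L ≤ length L′
      go k {L} r≤ gr with any? (extends? L)
      ... | no ¬ext = L , gr , (λ V V∉L → (λ R → ¬ext (V , V∉L , inj₁ R)) , λ X X∈L A → ¬ext (V , V∉L , inj₂ (X , X∈L , A))) , ≤-refl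
      go zero {L} r≤ gr | yes (V , V∉L , why) =
        contradiction (growth-length≤ (grow V∉L why gr)) (<⇒≱ (s≤s (≤-trans r≤ (≤-reflexive (+-identityʳ _)))))
      go (suc k) {L} r≤ gr | yes (V , V∉L , why) =
        let (L′ , gr′ , sat , l) = go k (≤-trans r≤ (≤-reflexive (+-suc _ k))) (grow V∉L why gr)
        in L′ , gr′ , sat , ≤-trans (n≤1+n _) l

    -- An arc may turn into a root: recolouring can make a class small while destroying an arc out
    -- of it.
    growth-map : ∀ {Root′ : Fin r → Set} {Arc′ : Fin r → Fin r → Set} {L} →
      (∀ V → V ∈ L → Root V → Root′ V) → (∀ V X → V ∈ L → X ∈ L → Arc V X → Root′ V ⊎ Arc′ V X) →
      Growth Root Arc L → Growth Root′ Arc′ L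
    growth-map ρ φ [] = []
    growth-map {Root′} {Arc′} ρ φ (grow {V} {L} V∉L why gr) =
      grow V∉L (next why) (growth-map (λ V m → ρ V (there m)) (λ V X m n → φ V X (there m) (there n)) gr)
      where
      next : Root V ⊎ (∃ λ X → X ∈ L × Arc V X) → Root′ V ⊎ (∃ λ X → X ∈ L × Arc′ V X)
      next (inj₁ R) = inj₁ (ρ V (here refl) R)
      next (inj₂ (X , X∈L , A)) with φ V X (here refl) (there X∈L) A
      ... | inj₁ R′ = inj₁ R′
      ... | inj₂ A′ = inj₂ (X , X∈L , A′)

  module _ {Γ : Fin r → Fin r → Set} (Γ-sym : ∀ {V X} → Γ V X → Γ X V)
           (Γ? : ∀ V X → Dec (Γ V X)) where

    Closed : List (Fin r) → Set
    Closed M = ∀ V X → X ∈ M → Γ V X → V ∈ M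

    saturated⇒closed : ∀ {Root : Fin r → Set} {M} → Saturated Root Γ M → Closed M
    saturated⇒closed {M = M} sat V X X∈M γ with V ∈? M
    ... | yes V∈M = V∈M
    ... | no V∉M = contradiction γ (proj₂ (sat V V∉M) X X∈M)

    private
      -- Follows the growth of `K` back to its root; symmetry of `Γ` lets closedness be used against
      -- the direction of growth.
      root-in : ∀ {Z K M} → Closed M → Growth (_≡ Z) Γ K → ∀ V → V ∈ K → V ∈ M → Z ∈ M
      root-in cl (grow _ (inj₁ refl) gr) V (here refl) V∈M = V∈M
      root-in cl (grow _ (inj₂ (X , X∈K , γ)) gr) V (here refl) V∈M = root-in cl gr X X∈K (cl X V V∈M (Γ-sym γ))
      root-in cl (grow _ _ gr) V (there V∈K) V∈M = root-in cl gr V V∈K V∈M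

      all-in : ∀ {Z K M} → Closed M → Growth (_≡ Z) Γ K → Z ∈ M → ∀ V → V ∈ K → V ∈ M
      all-in cl (grow _ (inj₁ refl) gr) Z∈M V (here refl) = Z∈M
      all-in cl (grow _ (inj₂ (X , X∈K , γ)) gr) Z∈M V (here refl) = cl V X (all-in cl gr Z∈M X X∈K) γ
      all-in cl (grow _ _ gr) Z∈M V (there V∈K) = all-in cl gr Z∈M V V∈K

    component : ∀ Z → ∃ λ K → Growth (_≡ Z) Γ K × Closed K × Z ∈ K
    component Z with saturate (_≟ Z) Γ? []
    ... | K , gr , sat , _ = K , gr , saturated⇒closed sat , Z∈K
      where
      Z∈K : Z ∈ K
      Z∈K with Z ∈? K
      ... | yes Z∈K = Z∈K
      ... | no Z∉K = contradiction refl (proj₁ (sat Z Z∉K))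

    -- Any member generates the whole component. The exchange of vertices will make one particular
    -- class of `K` small, and that class has to be the root of the resulting chain.
    reroot : ∀ {Z K} → Growth (_≡ Z) Γ K → Closed K → ∀ V → V ∈ K →
      ∃ λ K′ → Growth (_≡ V) Γ K′ × (∀ X → X ∈ K → X ∈ K′) × (∀ X → X ∈ K′ → X ∈ K)
    reroot gr cl V V∈K with component V
    ... | K′ , gr′ , cl′ , V∈K′ = K′ , gr′ , all-in cl′ gr (root-in cl′ gr V V∈K V∈K′) , all-in cl gr′ V∈K

-- Partial colourings and class sizes

-- Vertices mapped to `nothing` are the ones not coloured yet.
PartialColoring : ℕ → ℕ → Set
PartialColoring n r = Fin n → Maybe (Fin r)

module _ {n r : ℕ} where

  cl : PartialColoring n r → Fin r → Fin n → Bool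
  cl f i v = ⌊ ≡-dec _≟_ (f v) (just i) ⌋

  cl-true : ∀ f {i v} → cl f i v ≡ true → f v ≡ just i
  cl-true f {i} {v} e with ≡-dec _≟_ (f v) (just i)
  ... | yes p = p

  true-cl : ∀ f {i v} → f v ≡ just i → cl f i v ≡ true
  true-cl f {i} {v} e with ≡-dec _≟_ (f v) (just i)
  ... | yes _ = refl
  ... | no ¬e = contradiction e ¬e

  false-cl : ∀ f {i v} → f v ≢ just i → cl f i v ≡ false
  false-cl f ¬e = ≡false (¬e ∘ cl-true f)

  size : PartialColoring n r → Fin r → ℕ
  size f i = ∑ (λ v → ⟦ cl f i v ⟧)

  cl-cong : ∀ f g {i v} → (f v ≡ just i → g v ≡ just i) → (g v ≡ just i → f v ≡ just i) → cl f i v ≡ cl g i v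
  cl-cong f g {i} {v} to from with ≡-dec _≟_ (f v) (just i)
  ... | yes e = ≡-sym (true-cl g (to e))
  ... | no ¬e = ≡-sym (false-cl g (¬e ∘ from))

  size-cong : ∀ f g {i} → (∀ v → f v ≡ just i → g v ≡ just i) → (∀ v → g v ≡ just i → f v ≡ just i) → size f i ≡ size g i
  size-cong f g to from = ∑-cong λ v → cong ⟦_⟧ (cl-cong f g (to v) (from v))

  set : PartialColoring n r → Fin n → Maybe (Fin r) → PartialColoring n r
  set f u c v = if ⌊ v ≟ u ⌋ then c else f v

  set-same : ∀ f u c → set f u c u ≡ c
  set-same f u c rewrite ≟-refl u = refl

  set-other : ∀ f u c {v} → v ≢ u → set f u c v ≡ f v
  set-other f u c v≢u rewrite ≟-false v≢u = refl

  set-inv : ∀ f u c {v i} → set f u c v ≡ just i → (v ≡ u × c ≡ just i) ⊎ (v ≢ u × f v ≡ just i)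
  set-inv f u c {v} e with v ≟ u
  ... | yes v≡u = inj₁ (v≡u , e)
  ... | no v≢u = inj₂ (v≢u , e)

  private
    size-set : ∀ f u c {i} → ⟦ cl (set f u c) i u ⟧ + size f i ≡ ⟦ cl f i u ⟧ + size (set f u c) i
    size-set f u c {i} = ∑-update u λ v v≢u →
      cong ⟦_⟧ (cl-cong f (set f u c) (trans (set-other f u c v≢u)) (trans (≡-sym (set-other f u c v≢u))))

  size-set-enter : ∀ f u {i} → f u ≢ just i → size (set f u (just i)) i ≡ suc (size f i)
  size-set-enter f u {i} fu≢ with size-set f u (just i) {i}
  ... | e rewrite true-cl (set f u (just i)) {i} {u} (set-same f u (just i)) | false-cl f fu≢ = ≡-sym e

  size-set-leave : ∀ f u c {i} → f u ≡ just i → c ≢ just i → suc (size (set f u c) i) ≡ size f i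
  size-set-leave f u c {i} fu≡ c≢ with size-set f u c {i}
  ... | e rewrite false-cl (set f u c) {i} {u} (λ e → c≢ (trans (≡-sym (set-same f u c)) e)) | true-cl f fu≡ = ≡-sym e

  size-set-other : ∀ f u c {i} → f u ≢ just i → c ≢ just i → size (set f u c) i ≡ size f i
  size-set-other f u c {i} fu≢ c≢ with size-set f u c {i}
  ... | e rewrite false-cl (set f u c) {i} {u} (λ e → c≢ (trans (≡-sym (set-same f u c)) e)) | false-cl f fu≢ = ≡-sym e

  Balanced : ℕ → PartialColoring n r → Set
  Balanced t f = ∀ i → size f i ≡ t ⊎ size f i ≡ suc t

  balanced⇒size≤ : ∀ {t f} → Balanced t f → ∀ i → size f i ≤ suc t
  balanced⇒size≤ {t} bal i with bal i
  ... | inj₁ e = ≤-trans (≤-reflexive e) (n≤1+n t)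
  ... | inj₂ e = ≤-reflexive e

  SameDomain : PartialColoring n r → PartialColoring n r → Set
  SameDomain f g = ∀ v → is-just (f v) ≡ is-just (g v)

  set-domain : ∀ f u c → is-just c ≡ is-just (f u) → SameDomain (set f u c) f
  set-domain f u c e v with v ≟ u
  ... | yes refl = e
  ... | no _ = refl

  -- Compares classes rather than vertices, so that vertices may move among the classes of `M`.
  AgreeOff : List (Fin r) → PartialColoring n r → PartialColoring n r → Set
  AgreeOff M f g = ∀ i → i ∉ M → ∀ v → (f v ≡ just i → g v ≡ just i) × (g v ≡ just i → f v ≡ just i)

-- Shifting along arcs and placing a vertex

module Moves {n : ℕ} (G : Graph n) {r : ℕ} (t : ℕ) where

  private
    Coloring = PartialColoring n r

  Proper : Coloring → Set
  Proper f = ∀ u v i → f u ≡ just i → f v ≡ just i → adj G u v ≡ false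

  Free : Coloring → Fin n → Fin r → Set
  Free f u i = ∀ v → f v ≡ just i → adj G u v ≡ false

  Arc : Coloring → Fin r → Fin r → Set
  Arc f V X = ∃ λ u → f u ≡ just V × Free f u X

  Small : Coloring → Fin r → Set
  Small f V = size f V ≡ t

  Chain : Coloring → List (Fin r) → Set
  Chain f = Growth (Small f) (Arc f)

  Free? : ∀ f u i → Dec (Free f u i)
  Free? f u i = all? λ v → ≡-dec _≟_ (f v) (just i) →-dec (adj G u v Data.Bool.≟ false)

  Arc? : ∀ f V X → Dec (Arc f V X)
  Arc? f V X = any? λ u → ≡-dec _≟_ (f u) (just V) ×-dec Free? f u X

  Small? : ∀ f V → Dec (Small f V)
  Small? f V = size f V Data.Nat.≟ t

  Free-⊆ : ∀ {f g u i} → (∀ v → g v ≡ just i → f v ≡ just i) → Free f u i → Free g u i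
  Free-⊆ sub free v e = free v (sub v e)

  Proper-set : ∀ f u i → Proper f → Free f u i → Proper (set f u (just i))
  Proper-set f u i pr free a b j ea eb with set-inv f u (just i) ea | set-inv f u (just i) eb
  ... | inj₁ (refl , _) | inj₁ (refl , _) = irrefl G u
  ... | inj₁ (refl , refl) | inj₂ (_ , fb) = free b fb
  ... | inj₂ (_ , fa) | inj₁ (refl , refl) = trans (sym G a u) (free a fa)
  ... | inj₂ (_ , fa) | inj₂ (_ , fb) = pr a b j fa fb

  Proper-unset : ∀ f u → Proper f → Proper (set f u nothing)
  Proper-unset f u pr a b j ea eb with set-inv f u nothing ea | set-inv f u nothing eb
  ... | inj₂ (_ , fa) | inj₂ (_ , fb) = pr a b j fa fb

  -- By `shrinks`, a vertex free for `V` before is free for it afterwards; by `agree`, the witness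
  -- of an arc from outside `M` into `M` is still in its class.
  record Shifted (f : Coloring) (M : List (Fin r)) (V : Fin r) : Set where
    field
      new      : Coloring
      proper   : Proper new
      balanced : Balanced t new
      small    : Small new V
      shrinks  : ∀ v → new v ≡ just V → f v ≡ just V
      domain   : SameDomain new f
      agree    : AgreeOff M new f

  -- The vertices witnessing the arcs from V down to a small class move one step each.
  shift : ∀ f {M} → Proper f → Balanced t f → Chain f M → ∀ V → V ∈ M → Shifted f M V
  shift f {V₀ ∷ M} pr bal (grow V∉M why ch) V (there V∈M) = record
    { new = new ; proper = proper ; balanced = balanced ; small = small ; shrinks = shrinks ; domain = domain
    ; agree = λ i i∉ → agree i (i∉ ∘ there) }
    where open Shifted (shift f pr bal ch V V∈M)
  shift f {V ∷ M} pr bal (grow V∉M why ch) .V (here refl) with Small? f V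
  -- The path stops at the first small class it meets; a class that is not small has `t + 1`
  -- vertices and can lose one.
  ... | yes sm = record
    { new = f ; proper = pr ; balanced = bal ; small = sm ; shrinks = λ _ e → e ; domain = λ _ → refl
    ; agree = λ _ _ _ → (λ e → e) , (λ e → e) }
  shift f {V ∷ M} pr bal (grow V∉M (inj₁ sm) ch) .V (here refl) | no ¬sm = contradiction sm ¬sm
  shift f {V ∷ M} pr bal (grow V∉M (inj₂ (X , X∈M , u , fu , free)) ch) .V (here refl) | no ¬sm = record
    { new = g
    ; proper = Proper-set new u X proper (Free-⊆ {f} shrinks free)
    ; balanced = bal′
    ; small = gV
    ; shrinks = λ v e → shr v (set-inv new u (just X) e)
    ; domain = λ v → trans (set-domain new u (just X) (≡-sym (cong is-just newu)) v) (domain v)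
    ; agree = λ i i∉ v → (λ e → to i i∉ v (set-inv new u (just X) e)) , from i i∉ v }
    where
    open Shifted (shift f pr bal ch X X∈M)
    V≢X : V ≢ X
    V≢X refl = V∉M X∈M
    newu : new u ≡ just V
    newu = proj₂ (agree V V∉M u) fu
    g : Coloring
    g = set new u (just X)
    gV : Small g V
    gV with bal V
    ... | inj₁ sm = contradiction sm ¬sm
    ... | inj₂ e = suc-injective (trans (size-set-leave new u (just X) newu (V≢X ∘ ≡-sym ∘ just-injective))
                     (trans (size-cong new f (λ v → proj₁ (agree V V∉M v)) (λ v → proj₂ (agree V V∉M v))) e))
    bal′ : Balanced t g
    bal′ i with i ≟ V | i ≟ X
    ... | yes refl | _ = inj₁ gV
    ... | no _ | yes refl = inj₂ (trans (size-set-enter new u (λ e → V≢X (just-injective (trans (≡-sym newu) e)))) (cong suc small))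
    ... | no i≢V | no i≢X = subst (λ k → k ≡ t ⊎ k ≡ suc t)
      (≡-sym (size-set-other new u (just X) (λ e → i≢V (≡-sym (just-injective (trans (≡-sym newu) e)))) (i≢X ∘ ≡-sym ∘ just-injective))) (balanced i)
    shr : ∀ v → (v ≡ u × just X ≡ just V) ⊎ (v ≢ u × new v ≡ just V) → f v ≡ just V
    shr v (inj₁ (_ , e)) = contradiction (≡-sym (just-injective e)) V≢X
    shr v (inj₂ (_ , e)) = proj₁ (agree V V∉M v) e
    to : ∀ i → i ∉ V ∷ M → ∀ v → (v ≡ u × just X ≡ just i) ⊎ (v ≢ u × new v ≡ just i) → f v ≡ just i
    to i i∉ v (inj₁ (_ , refl)) = contradiction (there X∈M) i∉
    to i i∉ v (inj₂ (_ , e)) = proj₁ (agree i (i∉ ∘ there) v) e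
    from : ∀ i → i ∉ V ∷ M → ∀ v → f v ≡ just i → g v ≡ just i
    from i i∉ v e = trans (set-other new u (just X) (λ { refl → i∉ (here (just-injective (trans (≡-sym e) fu))) }))
      (proj₂ (agree i (i∉ ∘ there) v) e)

  record Placed (f : Coloring) (M : List (Fin r)) (x : Fin n) : Set where
    field
      new      : Coloring
      proper   : Proper new
      balanced : Balanced t new
      colored  : is-just (new x) ≡ true
      domain   : ∀ v → v ≢ x → is-just (new v) ≡ is-just (f v)
      agree    : AgreeOff M new f

  place : ∀ f {M} → Proper f → Balanced t f → Chain f M → ∀ x → f x ≡ nothing → ∀ V → V ∈ M → Free f x V → Placed f M x
  place f {M} pr bal ch x fx V V∈M free = record
    { new = g
    ; proper = Proper-set new x V proper (Free-⊆ {f} shrinks free)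
    ; balanced = bal′
    ; colored = cong is-just (set-same new x (just V))
    ; domain = λ v v≢x → trans (cong is-just (set-other new x (just V) v≢x)) (domain v)
    ; agree = λ i i∉ v → (λ e → to i i∉ v (set-inv new x (just V) e)) , from i i∉ v }
    where
    open Shifted (shift f pr bal ch V V∈M)
    g : Coloring
    g = set new x (just V)
    newx : ∀ {i} → new x ≢ just i
    newx e = true≢false (trans (≡-sym (domain x)) (cong is-just e)) (cong is-just fx)
    bal′ : Balanced t g
    bal′ i with i ≟ V
    ... | yes refl = inj₂ (trans (size-set-enter new x newx) (cong suc small))
    ... | no i≢V = subst (λ k → k ≡ t ⊎ k ≡ suc t) (≡-sym (size-set-other new x (just V) newx (i≢V ∘ ≡-sym ∘ just-injective))) (balanced i)
    to : ∀ i → i ∉ M → ∀ v → (v ≡ x × just V ≡ just i) ⊎ (v ≢ x × new v ≡ just i) → f v ≡ just i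
    to i i∉ v (inj₁ (_ , refl)) = contradiction V∈M i∉
    to i i∉ v (inj₂ (_ , e)) = proj₁ (agree i i∉ v) e
    from : ∀ i → i ∉ M → ∀ v → f v ≡ just i → g v ≡ just i
    from i i∉ v e = trans (set-other new x (just V) (λ { refl → contradiction (trans (≡-sym fx) e) λ () })) (proj₂ (agree i i∉ v) e)

-- Neighbours and edges counted class by class

two-terms≤∑ : ∀ {n} (g : Fin n → ℕ) {u v} → u ≢ v → g u + g v ≤ ∑ g
two-terms≤∑ {n} g {u} {v} u≢v = begin
  g u + g v       ≡⟨ cong (λ b → g u + (if b then 0 else g v)) (≟-false (u≢v ∘ ≡-sym)) ⟨
  g u + g′ v      ≤⟨ +-monoʳ-≤ (g u) (term≤∑ g′ v) ⟩
  g u + ∑ g′      ≡⟨ ∑-update u (λ i i≢u → ≡-sym (cong (λ b → if b then 0 else g i) (≟-false i≢u))) ⟨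
  g′ u + ∑ g      ≡⟨ cong (λ b → (if b then 0 else g u) + ∑ g) (≟-refl u) ⟩
  ∑ g             ∎
  where
  open ≤-Reasoning
  g′ : Fin n → ℕ
  g′ i = if ⌊ i ≟ u ⌋ then 0 else g i

module Counting {n : ℕ} (G : Graph n) {r : ℕ} (t : ℕ) (f : PartialColoring n r) where

  open Sparse G
  open Moves G {r} t

  hits : Fin n → Fin r → ℕ
  hits u i = ∑ λ v → ⟦ cl f i v ⟧ * α u v

  hit-term : ∀ {u v i} → f v ≡ just i → adj G u v ≡ true → ⟦ cl f i v ⟧ * α u v ≡ 1
  hit-term fv uv rewrite true-cl f fv | uv = refl

  ¬Free⇒hits : ∀ {u i} → ¬ Free f u i → 1 ≤ hits u i
  ¬Free⇒hits {u} {i} ¬free with hits u i in eq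
  ... | suc _ = s≤s z≤n
  ... | zero = contradiction (λ v fv → ≡false λ uv → contradiction
      (≤-trans (≤-reflexive (≡-sym (hit-term fv uv))) (≤-trans (term≤∑ (λ v → ⟦ cl f i v ⟧ * α u v) v) (≤-reflexive eq))) λ ()) ¬free

  hits≡1⇒unique : ∀ {u i v v′} → hits u i ≡ 1 → f v ≡ just i → adj G u v ≡ true → f v′ ≡ just i → adj G u v′ ≡ true → v ≡ v′
  hits≡1⇒unique {u} {i} {v} {v′} h fv uv fv′ uv′ with v ≟ v′
  ... | yes e = e
  ... | no v≢v′ = contradiction (≤-trans (≤-reflexive (≡-sym (cong₂ _+_ (hit-term fv uv) (hit-term fv′ uv′))))
      (≤-trans (two-terms≤∑ (λ v → ⟦ cl f i v ⟧ * α u v) v≢v′) (≤-reflexive h))) λ { (s≤s ()) }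

  within : (Fin r → Bool) → Fin n → Bool
  within M y = maybe′ M false (f y)

  within-just : ∀ M {y} → within M y ≡ true → ∃ λ V → f y ≡ just V × M V ≡ true
  within-just M {y} e with f y
  ... | just V = V , refl , e

  just-within : ∀ M {y V} → f y ≡ just V → M V ≡ true → within M y ≡ true
  just-within M {y} fy MV rewrite fy = MV

  within≡∑ : ∀ M y → ⟦ within M y ⟧ ≡ ∑ λ V → ⟦ M V ⟧ * ⟦ cl f V y ⟧
  within≡∑ M y = go (f y) refl
    where
    go : ∀ m → f y ≡ m → ⟦ maybe′ M false m ⟧ ≡ ∑ λ V → ⟦ M V ⟧ * ⟦ cl f V y ⟧
    go nothing fy = ≡-sym (∑-zero λ V → trans (cong (λ b → ⟦ M V ⟧ * ⟦ b ⟧) (false-cl f {V} {y} λ e → contradiction (trans (≡-sym fy) e) λ ())) (*-zeroʳ ⟦ M V ⟧))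
    go (just V) fy = ≡-sym (trans
      (∑-point (λ X → ⟦ M X ⟧ * ⟦ cl f X y ⟧) V λ X X≢V →
        trans (cong (λ b → ⟦ M X ⟧ * ⟦ b ⟧) (false-cl f {X} {y} λ e → X≢V (just-injective (trans (≡-sym e) fy)))) (*-zeroʳ ⟦ M X ⟧))
      (trans (cong (λ b → ⟦ M V ⟧ * ⟦ b ⟧) (true-cl f fy)) (*-identityʳ ⟦ M V ⟧)))

  ∑-within : ∀ M (g : Fin n → ℕ) → ∑ (λ y → ⟦ within M y ⟧ * g y) ≡ ∑ λ V → ⟦ M V ⟧ * ∑ λ y → ⟦ cl f V y ⟧ * g y
  ∑-within M g = begin
    ∑ (λ y → ⟦ within M y ⟧ * g y)
      ≡⟨ ∑-cong (λ y → trans (*-comm ⟦ within M y ⟧ (g y)) (trans (cong (g y *_) (within≡∑ M y)) (*-∑ (g y) _))) ⟩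
    ∑ (λ y → ∑ λ V → g y * (⟦ M V ⟧ * ⟦ cl f V y ⟧))
      ≡⟨ ∑-swap (λ y V → g y * (⟦ M V ⟧ * ⟦ cl f V y ⟧)) ⟩
    ∑ (λ V → ∑ λ y → g y * (⟦ M V ⟧ * ⟦ cl f V y ⟧))
      ≡⟨ ∑-cong (λ V → trans (∑-cong λ y → lem (g y) ⟦ M V ⟧ ⟦ cl f V y ⟧) (≡-sym (*-∑ ⟦ M V ⟧ _))) ⟩
    ∑ (λ V → ⟦ M V ⟧ * ∑ λ y → ⟦ cl f V y ⟧ * g y) ∎
    where
    open ≡-Reasoning
    lem : ∀ a b c → a * (b * c) ≡ b * (c * a)
    lem = solve-∀

  dom : Fin n → Bool
  dom v = is-just (f v)

  ∑-dom : ∀ (g : Fin n → ℕ) → ∑ (λ y → ⟦ dom y ⟧ * g y) ≡ ∑ λ V → ∑ λ y → ⟦ cl f V y ⟧ * g y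
  ∑-dom g = trans (∑-cong λ y → cong (λ b → ⟦ b ⟧ * g y) (dom≡ y))
    (trans (∑-within (λ _ → true) g) (∑-cong λ V → *-identityˡ _))
    where
    dom≡ : ∀ y → dom y ≡ within (λ _ → true) y
    dom≡ y with f y
    ... | just _ = refl
    ... | nothing = refl

  degIn-dom : ∀ u → degIn dom u ≡ ∑ (hits u)
  degIn-dom u = ∑-dom (α u)

  edgesBetween : Fin r → Fin r → ℕ
  edgesBetween V X = ∑ λ u → ⟦ cl f V u ⟧ * hits u X

  edgesBetween-sym : ∀ V X → edgesBetween V X ≡ edgesBetween X V
  edgesBetween-sym V X = begin
    ∑ (λ u → ⟦ cl f V u ⟧ * ∑ λ v → ⟦ cl f X v ⟧ * α u v)
      ≡⟨ ∑-cong (λ u → *-∑ ⟦ cl f V u ⟧ _) ⟩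
    ∑ (λ u → ∑ λ v → ⟦ cl f V u ⟧ * (⟦ cl f X v ⟧ * α u v))
      ≡⟨ ∑-swap (λ u v → ⟦ cl f V u ⟧ * (⟦ cl f X v ⟧ * α u v)) ⟩
    ∑ (λ v → ∑ λ u → ⟦ cl f V u ⟧ * (⟦ cl f X v ⟧ * α u v))
      ≡⟨ ∑-cong (λ v → ∑-cong λ u → trans (x∙yz≈y∙xz ⟦ cl f V u ⟧ ⟦ cl f X v ⟧ (α u v)) (cong (λ a → ⟦ cl f X v ⟧ * (⟦ cl f V u ⟧ * a)) (α-sym u v))) ⟩
    ∑ (λ v → ∑ λ u → ⟦ cl f X v ⟧ * (⟦ cl f V u ⟧ * α v u))
      ≡⟨ ∑-cong (λ v → *-∑ ⟦ cl f X v ⟧ _) ⟨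
    ∑ (λ v → ⟦ cl f X v ⟧ * ∑ λ u → ⟦ cl f V u ⟧ * α v u) ∎
    where open ≡-Reasoning

  -- Without an arc every vertex of `V` sends an edge to `X`.
  ¬Arc⇒edges : ∀ {V X} → ¬ Arc f V X → size f V ≤ edgesBetween V X
  ¬Arc⇒edges {V} {X} ¬arc = ∑-mono λ u → ≤-trans (≤-reflexive (≡-sym (*-identityʳ ⟦ cl f V u ⟧)))
    (⟦⟧*-mono (cl f V u) λ e → ¬Free⇒hits λ free → ¬arc (u , cl-true f e , free))

  -- Ordered pairs of classes see every edge from both ends, which is also how a degree sum counts
  -- it.
  totalEdges : ∑ (λ V → ∑ (edgesBetween V)) ≡ ∑ (λ u → ⟦ dom u ⟧ * degIn dom u)
  totalEdges = ≡-sym (begin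
    ∑ (λ u → ⟦ dom u ⟧ * degIn dom u)                    ≡⟨ ∑-dom (degIn dom) ⟩
    ∑ (λ V → ∑ λ u → ⟦ cl f V u ⟧ * degIn dom u)         ≡⟨ ∑-cong (λ V → ∑-cong λ u → trans (cong (⟦ cl f V u ⟧ *_) (degIn-dom u)) (*-∑ ⟦ cl f V u ⟧ (hits u))) ⟩
    ∑ (λ V → ∑ λ u → ∑ λ X → ⟦ cl f V u ⟧ * hits u X)    ≡⟨ ∑-cong (λ V → ∑-swap (λ u X → ⟦ cl f V u ⟧ * hits u X)) ⟩
    ∑ (λ V → ∑ (edgesBetween V))                         ∎)
    where open ≡-Reasoning

  domainSize : ∑ (⟦_⟧ ∘ dom) ≡ ∑ (size f)
  domainSize = trans (∑-cong λ y → ≡-sym (*-identityʳ ⟦ dom y ⟧))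
    (trans (∑-dom (λ _ → 1)) (∑-cong λ V → ∑-cong λ y → *-identityʳ ⟦ cl f V y ⟧))

  domainSize≤ : Balanced t f → ∑ (⟦_⟧ ∘ dom) ≤ r * suc t
  domainSize≤ bal = ≤-trans (≤-reflexive domainSize) (≤-trans (∑-mono (balanced⇒size≤ bal)) (≤-reflexive (∑-const r (suc t))))

-- A large component of two-way arcs

crossing≤ : ∀ a b e → ⟦ a ⟧ * (⟦ not b ⟧ * e) + ⟦ b ⟧ * (⟦ not a ⟧ * e) ≤ e
crossing≤ true  true  e = z≤n
crossing≤ true  false e = ≤-reflexive (trans (+-identityʳ _) (trans (*-identityˡ _) (*-identityˡ e)))
crossing≤ false true  e = ≤-reflexive (trans (*-identityˡ _) (*-identityˡ e))
crossing≤ false false e = z≤n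

module Component {n : ℕ} (G : Graph n) {p q r N h : ℕ} (t : ℕ) (6h<N : h * 6 < N) (0<p : 0 < p) (0<q : 0 < q)
  (sparse : (H : Subgraph G) → q * ‖ H ‖ₑ ≤ p * ∣ H ∣ᵥ) (Nd≤hr : N * p ≤ h * (q * r))
  (f : PartialColoring n r) where

  open Sparse G
  open Moves G {r} t
  open Counting G {r} t f

  instance
    q-nonZero : NonZero q
    q-nonZero = >-nonZero 0<q

  Γ : Fin r → Fin r → Set
  Γ V X = Arc f V X × Arc f X V

  Γ-sym : ∀ {V X} → Γ V X → Γ X V
  Γ-sym (a , b) = b , a

  Γ? : ∀ V X → Dec (Γ V X)
  Γ? V X = Arc? f V X ×-dec Arc? f X V

  6p<qr : 6 * p < q * r
  6p<qr = *-cancelˡ-< h _ _ (begin-strict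
    h * (6 * p)   ≡⟨ *-assoc h 6 p ⟨
    h * 6 * p     <⟨ *-monoˡ-< p {{>-nonZero 0<p}} 6h<N ⟩
    N * p         ≤⟨ Nd≤hr ⟩
    h * (q * r)   ∎)
    where open ≤-Reasoning

  -- `c` is the number of classes outside `K`. The last field is `c g ≤ d r` with `d` replaced by
  -- its upper bound `h r / N`.
  record BigComponent (L : List (Fin r)) : Set where
    field
      {Z}     : Fin r
      K       : List (Fin r)
      growth  : Growth (_≡ Z) Γ K
      closed  : Closed Γ-sym Γ? K
      outside : ∀ V → V ∈ K → V ∉ L
      fullSize : ∀ V → V ∈ K → size f V ≡ suc t
      c       : ℕ
      c+g≡r   : c + length K ≡ r
      c<g     : c < length K
      cg≤     : N * (c * length K) ≤ h * (r * r)

  module _ (bal : Balanced t f) where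

    totalEdges≤ : q * ∑ (λ V → ∑ (edgesBetween V)) ≤ 2 * p * (r * suc t)
    totalEdges≤ = begin
      q * ∑ (λ V → ∑ (edgesBetween V))       ≡⟨ cong (q *_) totalEdges ⟩
      q * ∑ (λ u → ⟦ dom u ⟧ * degIn dom u)  ≤⟨ degreeSum≤ {p} {q} sparse dom ⟩
      2 * p * ∑ (⟦_⟧ ∘ dom)                  ≤⟨ *-monoʳ-≤ (2 * p) (domainSize≤ bal) ⟩
      2 * p * (r * suc t)                    ∎
      where open ≤-Reasoning

    module _ {L : List (Fin r)} (ch : Chain f L) (sat : Saturated (Small f) (Arc f) L)
             (x : Fin n) (x-hits : ∀ V → V ∈ L → ¬ Free f x V) (x-low : q * degIn dom x ≤ 2 * p) where

      outside-size : ∀ {V} → V ∉ L → size f V ≡ suc t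
      outside-size {V} V∉L with bal V
      ... | inj₁ e = contradiction e (proj₁ (sat V V∉L))
      ... | inj₂ e = e

      -- If `V` has an arc to `X`, saturation puts `X` outside `L` as well. So whichever arc is
      -- missing would start at a class of `t + 1` vertices.
      ¬Γ⇒edges : ∀ {V X} → V ∉ L → ¬ Γ V X → suc t ≤ edgesBetween V X
      ¬Γ⇒edges {V} {X} V∉L ¬γ with Arc? f V X
      ... | no ¬arc = ≤-trans (≤-reflexive (≡-sym (outside-size V∉L))) (¬Arc⇒edges ¬arc)
      ... | yes arc = ≤-trans (≤-reflexive (≡-sym (outside-size λ X∈L → proj₂ (sat V V∉L) X X∈L arc)))
          (≤-trans (¬Arc⇒edges (λ arc′ → ¬γ (arc , arc′))) (≤-reflexive (edgesBetween-sym X V)))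

      -- The vertex `x` has a neighbour in each class of `L`, and at most `2d` coloured neighbours
      -- in all.
      chain-short : q * ∑ (⟦_⟧ ∘ member L) ≤ 2 * p
      chain-short = ≤-trans (*-monoʳ-≤ q (≤-trans (∑-mono bound) (≤-reflexive (≡-sym (degIn-dom x))))) x-low
        where
        bound : ∀ V → ⟦ member L V ⟧ ≤ hits x V
        bound V with member L V in eq
        ... | true = ¬Free⇒hits (x-hits V (member-∈ eq))
        ... | false = z≤n

      out : Fin r → Bool
      out V = not (member L V)

      out⇒∉ : ∀ {V} → out V ≡ true → V ∉ L
      out⇒∉ {V} e V∈L = true≢false e (cong not (∈-member V∈L))

      4p<qb : 4 * p < q * ∑ (⟦_⟧ ∘ out)
      4p<qb = +-cancelˡ-< (2 * p) _ _ (begin-strict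
        2 * p + 4 * p                                      ≡⟨ *-distribʳ-+ p 2 4 ⟨
        6 * p                                              <⟨ 6p<qr ⟩
        q * r                                              ≡⟨ cong (q *_) (∑-not (member L)) ⟨
        q * (∑ (⟦_⟧ ∘ member L) + ∑ (⟦_⟧ ∘ out))           ≡⟨ *-distribˡ-+ q _ _ ⟩
        q * ∑ (⟦_⟧ ∘ member L) + q * ∑ (⟦_⟧ ∘ out)         ≤⟨ +-monoˡ-≤ _ chain-short ⟩
        2 * p + q * ∑ (⟦_⟧ ∘ out)                          ∎)
        where open ≤-Reasoning

      nonΓ : Fin r → Fin r → Bool
      nonΓ V X = not ⌊ Γ? V X ⌋

      nonΓ-degree : Fin r → ℕ
      nonΓ-degree V = ∑ (λ X → ⟦ nonΓ V X ⟧)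

      nonΓ⇒edges : ∀ {V X} → V ∉ L → ⟦ nonΓ V X ⟧ * suc t ≤ edgesBetween V X
      nonΓ⇒edges {V} {X} V∉L with Γ? V X
      ... | yes _ = z≤n
      ... | no ¬γ = ≤-trans (≤-reflexive (*-identityˡ (suc t))) (¬Γ⇒edges V∉L ¬γ)

      ∑-nonΓ≤ : suc t * ∑ (λ V → ⟦ out V ⟧ * nonΓ-degree V) ≤ ∑ (λ V → ∑ (edgesBetween V))
      ∑-nonΓ≤ = ≤-trans (≤-reflexive (*-∑ (suc t) _)) (∑-mono bound)
        where
        open ≤-Reasoning
        bound : ∀ V → suc t * (⟦ out V ⟧ * nonΓ-degree V) ≤ ∑ (edgesBetween V)
        bound V with out V in eq
        ... | false = ≤-trans (≤-reflexive (*-zeroʳ (suc t))) z≤n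
        ... | true = begin
          suc t * (1 * nonΓ-degree V)         ≡⟨ cong (suc t *_) (*-identityˡ _) ⟩
          suc t * nonΓ-degree V               ≡⟨ *-∑ (suc t) _ ⟩
          ∑ (λ X → suc t * ⟦ nonΓ V X ⟧)      ≤⟨ ∑-mono (λ X → ≤-trans (≤-reflexive (*-comm (suc t) ⟦ nonΓ V X ⟧)) (nonΓ⇒edges (out⇒∉ eq))) ⟩
          ∑ (edgesBetween V)                  ∎

      0<r : 0 < r
      0<r = n≢0⇒n>0 λ r≡0 → contradiction (≤-trans (≤-trans (s≤s z≤n) 6p<qr) (≤-reflexive (trans (cong (q *_) r≡0) (*-zeroʳ q)))) λ ()

      -- Each missing pair costs `t + 1` edges, so at most `2dr` of them start outside `L`. Spread
      -- over more than `4d` classes, they leave one with fewer than `r / 2`.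
      ∃-wellConnected : ∃ λ Z → Z ∉ L × 2 * nonΓ-degree Z < r
      ∃-wellConnected =
        let (Z , eZ , le) = ∃-light out (λ V → 2 * nonΓ-degree V) (pred r) (subst (λ k → ∑ (λ V → ⟦ out V ⟧ * (2 * nonΓ-degree V)) < k * ∑ (⟦_⟧ ∘ out)) (≡-sym (suc-pred r)) light)
        in Z , out⇒∉ eZ , ≤-trans (s≤s le) (≤-reflexive (suc-pred r))
        where
        open ≤-Reasoning
        instance
          _ : NonZero (q * suc t)
          _ = m*n≢0 q (suc t)
          _ : NonZero r
          _ = >-nonZero 0<r
          _ : NonZero (r * suc t)
          _ = m*n≢0 r (suc t)
        lem₁ : ∀ q s e → q * s * (2 * e) ≡ 2 * (q * (s * e))
        lem₁ = solve-∀
        lem₂ : ∀ p r s → 2 * (2 * p * (r * s)) ≡ 4 * p * (r * s)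
        lem₂ = solve-∀
        lem₃ : ∀ q b r s → q * b * (r * s) ≡ q * s * (r * b)
        lem₃ = solve-∀
        light : ∑ (λ V → ⟦ out V ⟧ * (2 * nonΓ-degree V)) < r * ∑ (⟦_⟧ ∘ out)
        light = *-cancelˡ-< (q * suc t) _ _ (begin-strict
          q * suc t * ∑ (λ V → ⟦ out V ⟧ * (2 * nonΓ-degree V))
            ≡⟨ cong (q * suc t *_) (trans (∑-cong λ V → x∙yz≈y∙xz ⟦ out V ⟧ 2 _) (≡-sym (*-∑ 2 _))) ⟩
          q * suc t * (2 * ∑ (λ V → ⟦ out V ⟧ * nonΓ-degree V))
            ≡⟨ lem₁ q (suc t) _ ⟩
          2 * (q * (suc t * ∑ (λ V → ⟦ out V ⟧ * nonΓ-degree V)))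
            ≤⟨ *-monoʳ-≤ 2 (*-monoʳ-≤ q ∑-nonΓ≤) ⟩
          2 * (q * ∑ (λ V → ∑ (edgesBetween V)))
            ≤⟨ *-monoʳ-≤ 2 totalEdges≤ ⟩
          2 * (2 * p * (r * suc t))
            ≡⟨ lem₂ p r (suc t) ⟩
          4 * p * (r * suc t)
            <⟨ *-monoˡ-< (r * suc t) 4p<qb ⟩
          q * ∑ (⟦_⟧ ∘ out) * (r * suc t)
            ≡⟨ lem₃ q _ r (suc t) ⟩
          q * suc t * (r * ∑ (⟦_⟧ ∘ out)) ∎)

      growth-outside : ∀ {Z K} → Z ∉ L → Growth (_≡ Z) Γ K → ∀ V → V ∈ K → V ∉ L
      growth-outside Z∉L (grow _ (inj₁ refl) gr) V (here refl) = Z∉L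
      growth-outside Z∉L (grow _ (inj₂ (X , X∈K , _ , arc)) gr) V (here refl) V∈L = proj₂ (sat X (growth-outside Z∉L gr X X∈K)) V V∈L arc
      growth-outside Z∉L (grow _ _ gr) V (there V∈K) = growth-outside Z∉L gr V V∈K

      fromWellConnected : ∀ Z → Z ∉ L → 2 * nonΓ-degree Z < r →
        (∃ λ K → Growth (_≡ Z) Γ K × Closed Γ-sym Γ? K × Z ∈ K) → BigComponent L
      fromWellConnected Z Z∉L lt (K , gr , cl , Z∈K) = record
        { K = K ; growth = gr ; closed = cl ; outside = growth-outside Z∉L gr ; fullSize = λ V V∈K → outside-size (growth-outside Z∉L gr V V∈K) ; c = c
        ; c+g≡r = c+g ; c<g = c<g ; cg≤ = cg≤ }
        where
        open ≤-Reasoning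
        k k̄ : Fin r → ℕ
        k V = ⟦ member K V ⟧
        k̄ V = ⟦ not (member K V) ⟧
        g c s : ℕ
        g = length K
        c = ∑ k̄
        s = suc t
        ∑k≡g : ∑ k ≡ g
        ∑k≡g = growth-length gr
        c+g : c + g ≡ r
        c+g = trans (+-comm c g) (trans (cong (_+ c) (≡-sym ∑k≡g)) (∑-not (member K)))

        -- `K` is closed and contains `Z`, so no class outside `K` is a two-way neighbour of `Z`.
        cover : ∀ X → k̄ X ≤ ⟦ nonΓ Z X ⟧
        cover X with Γ? Z X
        ... | no _ = ⟦⟧≤1 (not (member K X))
        ... | yes γ = ≤-reflexive (cong (λ b → ⟦ not b ⟧) (∈-member (cl X Z Z∈K (Γ-sym γ))))

        c<g : c < g
        c<g = *-cancelˡ-< 2 _ _ (≤-<-trans (*-monoʳ-≤ 2 (∑-mono cover)) (≤-trans lt (≤-trans (≤-reflexive (≡-sym c+g)) c+g≤)))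
          where
          c+g≤ : c + g ≤ 2 * g
          c+g≤ with c ≤? g
          ... | yes l = ≤-trans (+-monoˡ-≤ g l) (≤-reflexive (cong (g +_) (≡-sym (+-identityʳ g))))
          ... | no ¬l = contradiction lt (≤⇒≯ (begin
            r         ≡⟨ c+g ⟨
            c + g     ≤⟨ +-monoʳ-≤ c (<⇒≤ (≰⇒> ¬l)) ⟩
            c + c     ≡⟨ cong (c +_) (+-identityʳ c) ⟨
            2 * c     ≤⟨ *-monoʳ-≤ 2 (∑-mono cover) ⟩
            2 * nonΓ-degree Z ∎))

        cross : Fin r → Fin r → ℕ
        cross V X = k V * (k̄ X * edgesBetween V X)

        cross≥ : s * (c * g) ≤ ∑ (λ V → ∑ (cross V))
        cross≥ = begin
          s * (c * g)                            ≡⟨ lem s c g ⟩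
          s * c * g                              ≡⟨ cong (s * c *_) ∑k≡g ⟨
          s * c * ∑ k                            ≡⟨ *-∑ (s * c) k ⟩
          ∑ (λ V → s * c * k V)                  ≡⟨ ∑-cong (λ V → trans (lem₂ s c (k V)) (trans (*-∑ (k V * s) k̄) (∑-cong λ X → lem₃ (k V) s (k̄ X)))) ⟩
          ∑ (λ V → ∑ λ X → k V * (k̄ X * s))      ≤⟨ ∑-mono (λ V → ∑-mono λ X → ⟦⟧*-mono (member K V) λ eV → ⟦⟧*-mono (not (member K X)) λ eX → sep V X eV eX) ⟩
          ∑ (λ V → ∑ (cross V))                  ∎
          where
          lem : ∀ s c g → s * (c * g) ≡ s * c * g
          lem = solve-∀
          lem₂ : ∀ s c g → s * c * g ≡ g * s * c
          lem₂ = solve-∀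
          lem₃ : ∀ a s b → a * s * b ≡ a * (b * s)
          lem₃ = solve-∀
          sep : ∀ V X → member K V ≡ true → not (member K X) ≡ true → s ≤ edgesBetween V X
          sep V X eV eX = ¬Γ⇒edges (growth-outside Z∉L gr V (member-∈ eV)) λ γ →
            true≢false eX (cong not (∈-member (cl X V (member-∈ eV) (Γ-sym γ))))

        -- A pair of classes separated by `K` enters the right side in both orders but `cross` in
        -- only one, whence the factor 2.
        cross≤ : 2 * ∑ (λ V → ∑ (cross V)) ≤ ∑ (λ V → ∑ (edgesBetween V))
        cross≤ = begin
          2 * C                                        ≡⟨ cong (C +_) (+-identityʳ C) ⟩
          C + C                                        ≡⟨ cong (C +_) (∑-swap cross) ⟩
          C + ∑ (λ V → ∑ λ X → cross X V)              ≡⟨ ∑-+ (λ V → ∑ (cross V)) (λ V → ∑ λ X → cross X V) ⟨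
          ∑ (λ V → ∑ (cross V) + ∑ (λ X → cross X V))  ≡⟨ ∑-cong (λ V → ≡-sym (∑-+ (cross V) (λ X → cross X V))) ⟩
          ∑ (λ V → ∑ λ X → cross V X + cross X V)      ≤⟨ ∑-mono (λ V → ∑-mono λ X → one V X) ⟩
          ∑ (λ V → ∑ (edgesBetween V))                 ∎
          where
          C : ℕ
          C = ∑ (λ V → ∑ (cross V))
          one : ∀ V X → cross V X + cross X V ≤ edgesBetween V X
          one V X = ≤-trans (≤-reflexive (cong (λ z → cross V X + k X * (k̄ V * z)) (edgesBetween-sym X V)))
            (crossing≤ (member K V) (member K X) (edgesBetween V X))

        -- The `c g` separated pairs span at least `t + 1` edges each, out of at most `d r (t + 1)`
        -- edges.
        qcg≤pr : q * (c * g) ≤ p * r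
        qcg≤pr = *-cancelˡ-≤ (2 * s) (begin
          2 * s * (q * (c * g))                 ≡⟨ lem₁ q s (c * g) ⟩
          q * (2 * (s * (c * g)))               ≤⟨ *-monoʳ-≤ q (≤-trans (*-monoʳ-≤ 2 cross≥) cross≤) ⟩
          q * ∑ (λ V → ∑ (edgesBetween V))      ≤⟨ totalEdges≤ ⟩
          2 * p * (r * s)                       ≡⟨ lem₂ p r s ⟩
          2 * s * (p * r)                       ∎)
          where
          lem₁ : ∀ q s m → 2 * s * (q * m) ≡ q * (2 * (s * m))
          lem₁ = solve-∀
          lem₂ : ∀ p r s → 2 * p * (r * s) ≡ 2 * s * (p * r)
          lem₂ = solve-∀

        cg≤ : N * (c * g) ≤ h * (r * r)
        cg≤ = *-cancelˡ-≤ q (begin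
          q * (N * (c * g))       ≡⟨ x∙yz≈y∙xz q N (c * g) ⟩
          N * (q * (c * g))       ≤⟨ *-monoʳ-≤ N qcg≤pr ⟩
          N * (p * r)             ≡⟨ *-assoc N p r ⟨
          N * p * r               ≤⟨ *-monoˡ-≤ r Nd≤hr ⟩
          h * (q * r) * r         ≡⟨ lem h q r ⟩
          q * (h * (r * r))       ∎)
          where
          lem : ∀ h q r → h * (q * r) * r ≡ q * (h * (r * r))
          lem = solve-∀

      bigComponent : BigComponent L
      bigComponent = let (Z , Z∉L , lt) = ∃-wellConnected in fromWellConnected Z Z∉L lt (component Γ-sym Γ? Z)

-- Dominating vertices inside a neighbourhood

module Dominated {n : ℕ} (G : Graph n) (w : Fin n) (S D : Fin n → Bool)
  (w∉S : S w ≡ false) (S-adj : ∀ y → S y ≡ true → adj G w y ≡ true) (D⊆S : ∀ y → D y ≡ true → S y ≡ true)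
  (D-dom : ∀ y z → D y ≡ true → S z ≡ true → y ≢ z → adj G y z ≡ true) where

  open Sparse G

  ∣S∣ ∣D∣ ∣S∖D∣ : ℕ
  ∣S∣ = ∑ (⟦_⟧ ∘ S)
  ∣D∣ = ∑ (⟦_⟧ ∘ D)
  ∣S∖D∣ = ∑ (λ y → ⟦ S y ∧ not (D y) ⟧)

  S-split : ∀ y → ⟦ S y ⟧ ≡ ⟦ D y ⟧ + ⟦ S y ∧ not (D y) ⟧
  S-split y with S y in eS | D y in eD
  ... | true  | true  = refl
  ... | true  | false = refl
  ... | false | false = refl
  ... | false | true  = ⊥-elim (true≢false (D⊆S y eD) eS)

  ∣S∣≡ : ∣S∣ ≡ ∣D∣ + ∣S∖D∣
  ∣S∣≡ = trans (∑-cong S-split) (∑-+ (⟦_⟧ ∘ D) (λ y → ⟦ S y ∧ not (D y) ⟧))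

  isW : Fin n → Bool
  isW y = ⌊ y ≟ w ⌋

  S₊ : Fin n → Bool
  S₊ y = S y ∨ isW y

  S₊-split : ∀ y → ⟦ S₊ y ⟧ ≡ ⟦ S y ⟧ + ⟦ isW y ⟧
  S₊-split y with S y in eS | y ≟ w
  ... | false | _     = refl
  ... | true  | no _  = refl
  ... | true  | yes refl = ⊥-elim (true≢false eS w∉S)

  ∑-isW : ∀ (g : Fin n → ℕ) → ∑ (λ y → ⟦ isW y ⟧ * g y) ≡ g w
  ∑-isW g = trans (∑-point (λ y → ⟦ isW y ⟧ * g y) w (λ y y≢w → cong (λ b → ⟦ b ⟧ * g y) (≟-false y≢w)))
    (trans (cong (λ b → ⟦ b ⟧ * g w) (≟-refl w)) (*-identityˡ (g w)))

  ∑-S₊ : ∀ (g : Fin n → ℕ) → ∑ (λ y → ⟦ S₊ y ⟧ * g y) ≡ ∑ (λ y → ⟦ S y ⟧ * g y) + g w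
  ∑-S₊ g = begin
    ∑ (λ y → ⟦ S₊ y ⟧ * g y)                                     ≡⟨ ∑-cong (λ y → trans (cong (_* g y) (S₊-split y)) (*-distribʳ-+ (g y) ⟦ S y ⟧ ⟦ isW y ⟧)) ⟩
    ∑ (λ y → ⟦ S y ⟧ * g y + ⟦ isW y ⟧ * g y)                   ≡⟨ ∑-+ (λ y → ⟦ S y ⟧ * g y) (λ y → ⟦ isW y ⟧ * g y) ⟩
    ∑ (λ y → ⟦ S y ⟧ * g y) + ∑ (λ y → ⟦ isW y ⟧ * g y)         ≡⟨ cong (∑ (λ y → ⟦ S y ⟧ * g y) +_) (∑-isW g) ⟩
    ∑ (λ y → ⟦ S y ⟧ * g y) + g w                               ∎
    where open ≡-Reasoning

  ∣S₊∣≡ : ∑ (⟦_⟧ ∘ S₊) ≡ suc ∣S∣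
  ∣S₊∣≡ = begin
    ∑ (⟦_⟧ ∘ S₊)                       ≡⟨ ∑-cong (λ y → *-identityʳ ⟦ S₊ y ⟧) ⟨
    ∑ (λ y → ⟦ S₊ y ⟧ * 1)             ≡⟨ ∑-S₊ (λ _ → 1) ⟩
    ∑ (λ y → ⟦ S y ⟧ * 1) + 1         ≡⟨ cong (_+ 1) (∑-cong λ y → *-identityʳ ⟦ S y ⟧) ⟩
    ∣S∣ + 1                           ≡⟨ +-comm ∣S∣ 1 ⟩
    suc ∣S∣                           ∎
    where open ≡-Reasoning

  degIn-S₊ : ∀ u → degIn S₊ u ≡ degIn S u + α u w
  degIn-S₊ u = ∑-S₊ (α u)

  degIn-S-w : degIn S w ≡ ∣S∣
  degIn-S-w = ∑-cong λ y → trans (⟦⟧*-cong (S y) λ e → cong ⟦_⟧ (S-adj y e)) (*-identityʳ ⟦ S y ⟧)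

  -- The added 1 stands for `y`, which lies in `S` but is not its own neighbour.
  degIn-D : ∀ y → D y ≡ true → ∣S∣ ≤ degIn S y + 1
  degIn-D y Dy = begin
    ∣S∣                                                       ≤⟨ ∑-mono bound ⟩
    ∑ (λ z → ⟦ S z ⟧ * α y z + ⟦ ⌊ z ≟ y ⌋ ⟧)                 ≡⟨ ∑-+ (λ z → ⟦ S z ⟧ * α y z) (λ z → ⟦ ⌊ z ≟ y ⌋ ⟧) ⟩
    degIn S y + ∑ (λ z → ⟦ ⌊ z ≟ y ⌋ ⟧)                       ≡⟨ cong (degIn S y +_) (trans (∑-point _ y (λ z z≢y → cong ⟦_⟧ (≟-false z≢y))) (cong ⟦_⟧ (≟-refl y))) ⟩
    degIn S y + 1                                             ∎
    where
    open ≤-Reasoning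
    bound : ∀ z → ⟦ S z ⟧ ≤ ⟦ S z ⟧ * α y z + ⟦ ⌊ z ≟ y ⌋ ⟧
    bound z with S z in eS | z ≟ y
    ... | false | _ = z≤n
    ... | true | yes _ = m≤n+m 1 _
    ... | true | no z≢y = ≤-trans (≤-reflexive (≡-sym (cong ⟦_⟧ (D-dom y z Dy eS (z≢y ∘ ≡-sym)))))
                            (≤-trans (≤-reflexive (≡-sym (*-identityˡ (α y z)))) (m≤m+n _ 0))

  degIn-S∖D : ∀ y → S y ≡ true → D y ≡ false → ∣D∣ ≤ degIn S y
  degIn-S∖D y Sy ¬Dy = ∑-mono bound
    where
    bound : ∀ z → ⟦ D z ⟧ ≤ ⟦ S z ⟧ * α y z
    bound z with D z in eD
    ... | false = z≤n
    ... | true = ≤-reflexive (≡-sym (cong₂ (λ a b → ⟦ a ⟧ * ⟦ b ⟧) (D⊆S z eD)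
        (trans (sym G y z) (D-dom z y eD Sy (λ { refl → true≢false eD ¬Dy })))))

  -- Within `S` together with `w`, the vertices of `D` and `w` have degree at least `∣S∣`, the
  -- others at least `suc ∣D∣`; the product collects these contributions.
  degreeSum-S₊≥ : suc ∣D∣ * (∣S∣ + ∣S∖D∣) ≤ ∑ (λ u → ⟦ S₊ u ⟧ * degIn S₊ u)
  degreeSum-S₊≥ = begin
    suc ∣D∣ * (∣S∣ + ∣S∖D∣)
      ≡⟨ lem ∣D∣ ∣S∣ ∣S∖D∣ ⟩
    (∣S∣ * ∣D∣ + suc ∣D∣ * ∣S∖D∣) + ∣S∣
      ≡⟨ cong (_+ ∣S∣) (cong₂ _+_ (*-∑ ∣S∣ (⟦_⟧ ∘ D)) (*-∑ (suc ∣D∣) (λ y → ⟦ S y ∧ not (D y) ⟧))) ⟩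
    (∑ (λ y → ∣S∣ * ⟦ D y ⟧) + ∑ (λ y → suc ∣D∣ * ⟦ S y ∧ not (D y) ⟧)) + ∣S∣
      ≡⟨ cong (_+ ∣S∣) (∑-+ (λ y → ∣S∣ * ⟦ D y ⟧) (λ y → suc ∣D∣ * ⟦ S y ∧ not (D y) ⟧)) ⟨
    ∑ (λ y → ∣S∣ * ⟦ D y ⟧ + suc ∣D∣ * ⟦ S y ∧ not (D y) ⟧) + ∣S∣
      ≤⟨ +-mono-≤ (∑-mono bound) (≤-trans (≤-reflexive (≡-sym degIn-S-w)) (≤-trans (m≤m+n _ _) (≤-reflexive (≡-sym (degIn-S₊ w))))) ⟩
    ∑ (λ y → ⟦ S y ⟧ * degIn S₊ y) + degIn S₊ w
      ≡⟨ ∑-S₊ (degIn S₊) ⟨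
    ∑ (λ u → ⟦ S₊ u ⟧ * degIn S₊ u) ∎
    where
    open ≤-Reasoning
    lem : ∀ d s e → (1 + d) * (s + e) ≡ (s * d + (1 + d) * e) + s
    lem = solve-∀
    degIn-S₊-S : ∀ y → S y ≡ true → degIn S y + 1 ≡ degIn S₊ y
    degIn-S₊-S y Sy = ≡-sym (trans (degIn-S₊ y) (cong (λ b → degIn S y + ⟦ b ⟧) (trans (sym G y w) (S-adj y Sy))))
    bound : ∀ y → ∣S∣ * ⟦ D y ⟧ + suc ∣D∣ * ⟦ S y ∧ not (D y) ⟧ ≤ ⟦ S y ⟧ * degIn S₊ y
    bound y with S y in eS | D y in eD
    ... | false | true  = ⊥-elim (true≢false (D⊆S y eD) eS)
    ... | false | false = ≤-reflexive (cong₂ _+_ (*-zeroʳ ∣S∣) (*-zeroʳ (suc ∣D∣)))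
    ... | true  | true  = begin
      ∣S∣ * 1 + suc ∣D∣ * 0 ≡⟨ trans (cong₂ _+_ (*-identityʳ ∣S∣) (*-zeroʳ (suc ∣D∣))) (+-identityʳ ∣S∣) ⟩
      ∣S∣                   ≤⟨ degIn-D y eD ⟩
      degIn S y + 1         ≡⟨ degIn-S₊-S y eS ⟩
      degIn S₊ y             ≡⟨ *-identityˡ _ ⟨
      1 * degIn S₊ y         ∎
    ... | true  | false = begin
      ∣S∣ * 0 + suc ∣D∣ * 1 ≡⟨ cong₂ _+_ (*-zeroʳ ∣S∣) (*-identityʳ (suc ∣D∣)) ⟩
      suc ∣D∣               ≤⟨ s≤s (degIn-S∖D y eS eD) ⟩
      suc (degIn S y)       ≡⟨ +-comm 1 (degIn S y) ⟩
      degIn S y + 1         ≡⟨ degIn-S₊-S y eS ⟩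
      degIn S₊ y             ≡⟨ *-identityˡ _ ⟨
      1 * degIn S₊ y         ∎

  dominated-bound : ∀ {p q r N h} → 0 < q → ((H : Subgraph G) → q * ‖ H ‖ₑ ≤ p * ∣ H ∣ᵥ) → N * p ≤ h * (q * r) →
    N * (suc ∣D∣ * (∣S∣ + ∣S∖D∣)) ≤ 2 * h * (r * suc ∣S∣)
  dominated-bound {p} {q} {r} {N} {h} 0<q sparse Nd≤hr = *-cancelˡ-≤ q {{>-nonZero 0<q}} (begin
    q * (N * (suc ∣D∣ * (∣S∣ + ∣S∖D∣)))                ≡⟨ x∙yz≈y∙xz q N _ ⟩
    N * (q * (suc ∣D∣ * (∣S∣ + ∣S∖D∣)))                ≤⟨ *-monoʳ-≤ N (*-monoʳ-≤ q degreeSum-S₊≥) ⟩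
    N * (q * ∑ (λ u → ⟦ S₊ u ⟧ * degIn S₊ u))            ≤⟨ *-monoʳ-≤ N (degreeSum≤ {p} {q} sparse S₊) ⟩
    N * (2 * p * ∑ (⟦_⟧ ∘ S₊))                          ≡⟨ cong (λ k → N * (2 * p * k)) ∣S₊∣≡ ⟩
    N * (2 * p * suc ∣S∣)                              ≡⟨ lem₁ N p (suc ∣S∣) ⟩
    N * p * (2 * suc ∣S∣)                              ≤⟨ *-monoˡ-≤ (2 * suc ∣S∣) Nd≤hr ⟩
    h * (q * r) * (2 * suc ∣S∣)                        ≡⟨ lem₂ h q r (suc ∣S∣) ⟩
    q * (2 * h * (r * suc ∣S∣))                        ∎)
    where
    open ≤-Reasoning
    lem₁ : ∀ N p s → N * (2 * p * s) ≡ N * p * (2 * s)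
    lem₁ = solve-∀
    lem₂ : ∀ h q r s → h * (q * r) * (2 * s) ≡ q * (2 * h * (r * s))
    lem₂ = solve-∀

≡ᵇ-true : ∀ {m n} → (m ≡ᵇ n) ≡ true → m ≡ n
≡ᵇ-true {m} {n} e = ≡ᵇ⇒≡ m n (subst T (≡-sym e) _)

-- Lengthening the chain by an exchange of vertices

module Improve {n : ℕ} (G : Graph n) {p q r N h : ℕ} (τ : Threshold N h) (t : ℕ) (0<p : 0 < p) (0<q : 0 < q)
  (sparse : (H : Subgraph G) → q * ‖ H ‖ₑ ≤ p * ∣ H ∣ᵥ) (Nd≤hr : N * p ≤ h * (q * r))
  (Δ≤r : ∀ v → degree G v ≤ r) (f : PartialColoring n r) where

  open Sparse G
  open Moves G {r} t
  open Counting G {r} t f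
  open Component G {N = N} {h = h} t (Threshold.6h<N τ) 0<p 0<q sparse Nd≤hr f

  record Improvement (L₀ : List (Fin r)) : Set where
    field
      new      : PartialColoring n r
      newChain : List (Fin r)
      proper   : Proper new
      balanced : Balanced t new
      domain   : SameDomain new f
      chain    : Chain new newChain
      longer   : length L₀ < length newChain

  module _ (pr : Proper f) (bal : Balanced t f) {W : Fin r} {L : List (Fin r)}
           (W∉L : W ∉ L) (W-why : Small f W ⊎ (∃ λ X → X ∈ L × Arc f W X)) (chL : Chain f L)
           (sat : Saturated (Small f) (Arc f) (W ∷ L))
           (big : BigComponent (W ∷ L)) where

    open BigComponent big

    private
      ch : Chain f (W ∷ L)
      ch = grow W∉L W-why chL

    g : ℕ
    g = length K

    inK : Fin r → Bool
    inK = member K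

    K≢W : ∀ {V} → V ∈ K → V ≢ W
    K≢W V∈K V≡W = outside _ V∈K (here V≡W)

    K∉L : ∀ {V} → V ∈ K → V ∉ L
    K∉L V∈K V∈L = outside _ V∈K (there V∈L)

    K-size : ∀ {V} → V ∈ K → size f V ≡ suc t
    K-size V∈K = fullSize _ V∈K

    K-hits-W : ∀ {y V} → f y ≡ just V → V ∈ K → 1 ≤ hits y W
    K-hits-W {y} fy V∈K = ¬Free⇒hits λ free → proj₂ (sat _ (outside _ V∈K)) W (here refl) (y , fy , free)

    chain+g≤r : suc (length L) + g ≤ r
    chain+g≤r = begin
      suc (length L) + g                                   ≡⟨ cong₂ _+_ (growth-length ch) (growth-length growth) ⟨
      ∑ (⟦_⟧ ∘ member (W ∷ L)) + ∑ (⟦_⟧ ∘ member K)         ≤⟨ +-monoʳ-≤ _ (∑-mono disjoint) ⟩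
      ∑ (⟦_⟧ ∘ member (W ∷ L)) + ∑ (λ V → ⟦ not (member (W ∷ L) V) ⟧) ≡⟨ ∑-not (member (W ∷ L)) ⟩
      r                                                    ∎
      where
      open ≤-Reasoning
      disjoint : ∀ V → ⟦ member K V ⟧ ≤ ⟦ not (member (W ∷ L) V) ⟧
      disjoint V with member K V in eq
      ... | false = z≤n
      ... | true = ≤-reflexive (≡-sym (cong (λ b → ⟦ not b ⟧) (∉-member (outside V (member-∈ eq)))))

    -- The chain is disjoint from `K`. Since `c < g`, a chain through all of `K` will therefore
    -- count as longer.
    chain≤c : suc (length L) ≤ c
    chain≤c = +-cancelʳ-≤ g _ _ (≤-trans chain+g≤r (≤-reflexive (≡-sym c+g≡r)))

    0<g : 0 < g
    0<g = ≤-trans (s≤s z≤n) c<g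

    solo : Fin n → Bool
    solo y = hits y W ≡ᵇ 1

    -- Solo neighbours count twice, so that every vertex of `K` contributes at least 2 to the total
    -- over `W`.
    weight : Fin n → ℕ
    weight v = ∑ λ y → ⟦ within inK y ⟧ * (α v y * suc ⟦ solo y ⟧)

    soloAdj : Fin n → Fin n → Bool
    soloAdj v y = adj G v y ∧ solo y

    S : Fin n → Fin n → Bool
    S v y = within inK y ∧ soloAdj v y

    K-vertices : ∑ (λ y → ⟦ within inK y ⟧ * 2) ≡ 2 * g * suc t
    K-vertices = begin
      ∑ (λ y → ⟦ within inK y ⟧ * 2)                    ≡⟨ ∑-within inK (λ _ → 2) ⟩
      ∑ (λ V → ⟦ inK V ⟧ * ∑ λ y → ⟦ cl f V y ⟧ * 2)    ≡⟨ ∑-cong (λ V → ⟦⟧*-cong (inK V) λ e → trans (∑-cong λ y → *-comm ⟦ cl f V y ⟧ 2) (trans (≡-sym (*-∑ 2 _)) (cong (2 *_) (K-size (member-∈ e))))) ⟩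
      ∑ (λ V → ⟦ inK V ⟧ * (2 * suc t))                 ≡⟨ ∑-cong (λ V → *-comm ⟦ inK V ⟧ (2 * suc t)) ⟩
      ∑ (λ V → 2 * suc t * ⟦ inK V ⟧)                   ≡⟨ *-∑ (2 * suc t) (⟦_⟧ ∘ inK) ⟨
      2 * suc t * ∑ (⟦_⟧ ∘ inK)                         ≡⟨ cong (2 * suc t *_) (growth-length growth) ⟩
      2 * suc t * g                                     ≡⟨ lem (suc t) g ⟩
      2 * g * suc t                                     ∎
      where
      open ≡-Reasoning
      lem : ∀ s g → 2 * s * g ≡ 2 * g * s
      lem = solve-∀

    totalWeight : ∑ (λ v → ⟦ cl f W v ⟧ * weight v) ≡ ∑ (λ y → ⟦ within inK y ⟧ * (suc ⟦ solo y ⟧ * hits y W))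
    totalWeight = begin
      ∑ (λ v → ⟦ cl f W v ⟧ * weight v)
        ≡⟨ ∑-cong (λ v → *-∑ ⟦ cl f W v ⟧ _) ⟩
      ∑ (λ v → ∑ λ y → ⟦ cl f W v ⟧ * (⟦ within inK y ⟧ * (α v y * suc ⟦ solo y ⟧)))
        ≡⟨ ∑-swap (λ v y → ⟦ cl f W v ⟧ * (⟦ within inK y ⟧ * (α v y * suc ⟦ solo y ⟧))) ⟩
      ∑ (λ y → ∑ λ v → ⟦ cl f W v ⟧ * (⟦ within inK y ⟧ * (α v y * suc ⟦ solo y ⟧)))
        ≡⟨ ∑-cong (λ y → trans (∑-cong λ v → trans (lem ⟦ cl f W v ⟧ ⟦ within inK y ⟧ (α v y) (suc ⟦ solo y ⟧)) (cong (λ a → ⟦ within inK y ⟧ * suc ⟦ solo y ⟧ * (⟦ cl f W v ⟧ * a)) (α-sym v y)))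
             (trans (≡-sym (*-∑ (⟦ within inK y ⟧ * suc ⟦ solo y ⟧) _)) (*-assoc ⟦ within inK y ⟧ (suc ⟦ solo y ⟧) (hits y W)))) ⟩
      ∑ (λ y → ⟦ within inK y ⟧ * (suc ⟦ solo y ⟧ * hits y W)) ∎
      where
      open ≡-Reasoning
      lem : ∀ a b c d → a * (b * (c * d)) ≡ b * d * (a * c)
      lem = solve-∀

    -- A solo vertex counts twice through its single edge to W, any other vertex through at least two edges.
    totalWeight≥ : 2 * g * suc t ≤ ∑ (λ v → ⟦ cl f W v ⟧ * weight v)
    totalWeight≥ = begin
      2 * g * suc t                                             ≡⟨ K-vertices ⟨
      ∑ (λ y → ⟦ within inK y ⟧ * 2)                            ≤⟨ ∑-mono (λ y → ⟦⟧*-mono (within inK y) (bound y)) ⟩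
      ∑ (λ y → ⟦ within inK y ⟧ * (suc ⟦ solo y ⟧ * hits y W))  ≡⟨ totalWeight ⟨
      ∑ (λ v → ⟦ cl f W v ⟧ * weight v)                         ∎
      where
      open ≤-Reasoning
      two : ∀ h → 1 ≤ h → 2 ≤ suc ⟦ h ≡ᵇ 1 ⟧ * h
      two (suc zero) _ = ≤-refl
      two (suc (suc h)) _ = s≤s (s≤s z≤n)
      bound : ∀ y → within inK y ≡ true → 2 ≤ suc ⟦ solo y ⟧ * hits y W
      bound y e = let (V , fy , eV) = within-just inK e in two (hits y W) (K-hits-W fy (member-∈ eV))

    -- Balance alone does not give this when `t` is 0; but `K` has vertices, and each has a
    -- neighbour in `W`.
    W-nonempty : 0 < size f W
    W-nonempty = n≢0⇒n>0 λ size≡0 → contradiction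
      (≤-trans (*-mono-≤ (*-mono-≤ (≤ᵇ⇒≤ 1 2 _) 0<g) (s≤s z≤n)) (≤-trans totalWeight≥ (≤-reflexive (∑-zero λ v →
        cong (_* weight v) (n≤0⇒n≡0 (≤-trans (term≤∑ (λ v → ⟦ cl f W v ⟧) v) (≤-reflexive size≡0)))))))
      λ ()

    -- At most `t + 1` vertices of `W` share a total weight of at least `2 g (t + 1)`.
    ∃-heavyVertex : ∃ λ w → cl f W w ≡ true × 2 * g ≤ weight w
    ∃-heavyVertex = ∃-heavy (cl f W) weight (2 * g) (≤-trans (*-monoʳ-≤ (2 * g) (balanced⇒size≤ bal W)) totalWeight≥) W-nonempty

    weight≡ : ∀ v → weight v ≡ degIn (within inK) v + ∑ (⟦_⟧ ∘ S v)
    weight≡ v = trans (∑-cong λ y → lem (within inK y) (adj G v y) (solo y)) (∑-+ (λ y → ⟦ within inK y ⟧ * α v y) (⟦_⟧ ∘ S v))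
      where
      lem : ∀ a b d → ⟦ a ⟧ * (⟦ b ⟧ * suc ⟦ d ⟧) ≡ ⟦ a ⟧ * ⟦ b ⟧ + ⟦ a ∧ (b ∧ d) ⟧
      lem false _ _ = refl
      lem true false _ = refl
      lem true true true = refl
      lem true true false = refl

    module Rotate {w : Fin n} (fw : f w ≡ just W) {y : Fin n} {V : Fin r} (fy : f y ≡ just V) (V∈K : V ∈ K)
                  (wy : adj G w y ≡ true) (y-solo : hits y W ≡ 1) where

      -- First `w` loses its colour, then `y` moves from `V` to `W`. This is proper because `w` was
      -- the only neighbour of `y` in `W`; `W` keeps its size, `V` becomes small, and `w` remains to
      -- be placed.
      f₀ f₁ : PartialColoring n r
      f₀ = set f w nothing
      f₁ = set f₀ y (just W)

      V≢W : V ≢ W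
      V≢W = K≢W V∈K

      w≢y : w ≢ y
      w≢y refl = V≢W (just-injective (trans (≡-sym fy) fw))

      f₀y : f₀ y ≡ just V
      f₀y = trans (set-other f w nothing (w≢y ∘ ≡-sym)) fy

      f₁w : f₁ w ≡ nothing
      f₁w = trans (set-other f₀ y (just W) w≢y) (set-same f w nothing)

      solo-unique : ∀ {z v} → hits z W ≡ 1 → adj G w z ≡ true → f v ≡ just W → v ≢ w → adj G z v ≡ false
      solo-unique {z} h wz fv v≢w = ≡false λ zv → v≢w (hits≡1⇒unique h fv zv fw (trans (sym G z w) wz))

      f₁-W : ∀ v → f₁ v ≡ just W → v ≡ y ⊎ (v ≢ w × f v ≡ just W)
      f₁-W v e with set-inv f₀ y (just W) e
      ... | inj₁ (v≡y , _) = inj₁ v≡y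
      ... | inj₂ (_ , e₀) with set-inv f w nothing e₀
      ...   | inj₂ (v≢w , fv) = inj₂ (v≢w , fv)

      f₁-W′ : ∀ v → f v ≡ just W → v ≢ w → f₁ v ≡ just W
      f₁-W′ v fv v≢w = trans (set-other f₀ y (just W) λ { refl → V≢W (just-injective (trans (≡-sym fy) fv)) }) (trans (set-other f w nothing v≢w) fv)

      f₁⊆f : ∀ {i} → i ≢ W → ∀ v → f₁ v ≡ just i → f v ≡ just i
      f₁⊆f i≢W v e with set-inv f₀ y (just W) e
      ... | inj₁ (_ , e′) = contradiction (≡-sym (just-injective e′)) i≢W
      ... | inj₂ (_ , e₀) with set-inv f w nothing e₀
      ...   | inj₂ (_ , fv) = fv

      f⊆f₁ : ∀ {i} → i ≢ W → ∀ v → v ≢ y → f v ≡ just i → f₁ v ≡ just i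
      f⊆f₁ i≢W v v≢y fv = trans (set-other f₀ y (just W) v≢y)
        (trans (set-other f w nothing λ { refl → i≢W (just-injective (trans (≡-sym fv) fw)) }) fv)

      proper₁ : Proper f₁
      proper₁ = Proper-set f₀ y W (Proper-unset f w pr) λ v e → free v (set-inv f w nothing e)
        where
        free : ∀ v → (v ≡ w × nothing ≡ just W) ⊎ (v ≢ w × f v ≡ just W) → adj G y v ≡ false
        free v (inj₂ (v≢w , fv)) = solo-unique y-solo wy fv v≢w

      size₁-W : size f₁ W ≡ size f W
      size₁-W = trans (size-set-enter f₀ y (λ e → V≢W (just-injective (trans (≡-sym f₀y) e)))) (size-set-leave f w nothing fw λ ())

      small₁-V : size f₁ V ≡ t
      small₁-V = suc-injective (trans (size-set-leave f₀ y (just W) f₀y (V≢W ∘ ≡-sym ∘ just-injective))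
        (trans (size-set-other f w nothing (λ e → V≢W (just-injective (trans (≡-sym e) fw))) λ ()) (K-size V∈K)))

      size₁-other : ∀ {i} → i ≢ W → i ≢ V → size f₁ i ≡ size f i
      size₁-other i≢W i≢V = size-cong f₁ f (f₁⊆f i≢W) λ v fv →
        f⊆f₁ i≢W v (λ { refl → i≢V (just-injective (trans (≡-sym fv) fy)) }) fv

      balanced₁ : Balanced t f₁
      balanced₁ i with i ≟ W | i ≟ V
      ... | yes refl | _ = subst (λ k → k ≡ t ⊎ k ≡ suc t) (≡-sym size₁-W) (bal W)
      ... | no _ | yes refl = inj₁ small₁-V
      ... | no i≢W | no i≢V = subst (λ k → k ≡ t ⊎ k ≡ suc t) (≡-sym (size₁-other i≢W i≢V)) (bal i)

      L≢W : ∀ {i} → i ∈ L → i ≢ W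
      L≢W i∈L refl = W∉L i∈L

      L≢V : ∀ {i} → i ∈ L → i ≢ V
      L≢V i∈L refl = K∉L V∈K i∈L

      -- The target may be `V`, which only loses a vertex; the source may not, since the witness
      -- could be `y`.
      arc₁ : ∀ {i j} → i ≢ W → i ≢ V → j ≢ W → Arc f i j → Arc f₁ i j
      arc₁ i≢W i≢V j≢W (u , fu , free) =
        u , f⊆f₁ i≢W u (λ { refl → i≢V (just-injective (trans (≡-sym fu) fy)) }) fu , Free-⊆ {f} (f₁⊆f j≢W) free

      chainL₁ : Chain f₁ L
      chainL₁ = growth-map (λ i i∈L → trans (size₁-other (L≢W i∈L) (L≢V i∈L)))
        (λ i j i∈L j∈L → inj₂ ∘ arc₁ (L≢W i∈L) (L≢V i∈L) (L≢W j∈L)) chL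

      module _ {K′ : List (Fin r)} (grK′ : Growth (_≡ V) Γ K′) (K⊆K′ : ∀ X → X ∈ K → X ∈ K′) (K′⊆K : ∀ X → X ∈ K′ → X ∈ K) where

        chainK₁ : Chain f₁ K′
        chainK₁ = growth-map (λ { i _ refl → small₁-V }) arcs grK′
          where
          arcs : ∀ i j → i ∈ K′ → j ∈ K′ → Γ i j → Small f₁ i ⊎ Arc f₁ i j
          arcs i j i∈K′ j∈K′ (arc , _) with i ≟ V
          ... | yes refl = inj₁ small₁-V
          ... | no i≢V = inj₂ (arc₁ (K≢W (K′⊆K i i∈K′)) i≢V (K≢W (K′⊆K j j∈K′)) arc)

        transfer : ∀ {M M′} {f₃ : PartialColoring n r} → AgreeOff M f₃ f₁ → (∀ i → i ∈ M′ → i ∉ M) → Chain f₁ M′ → Chain f₃ M′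
        transfer {M} {M′} {f₃} agree off = growth-map
          (λ i i∈M′ small → trans (size-cong f₃ f₁ (λ v → proj₁ (agree i (off i i∈M′) v)) (λ v → proj₂ (agree i (off i i∈M′) v))) small)
          (λ { i j i∈M′ j∈M′ (u , fu , free) → inj₂ (u , proj₂ (agree i (off i i∈M′) u) fu ,
                Free-⊆ {f₁} (λ v → proj₁ (agree j (off j j∈M′) v)) free) })

        domain₁ : ∀ v → v ≢ w → is-just (f₁ v) ≡ is-just (f v)
        domain₁ v v≢w = trans (set-domain f₀ y (just W) (cong is-just (≡-sym f₀y)) v) (cong is-just (set-other f w nothing v≢w))

        domain₃ : ∀ {M} (P : Placed f₁ M w) → SameDomain (Placed.new P) f
        domain₃ P v with v ≟ w
        ... | yes refl = trans (Placed.colored P) (cong is-just (≡-sym fw))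
        ... | no v≢w = trans (Placed.domain P v v≢w) (domain₁ v v≢w)

        g≤length-K′ : g ≤ length K′
        g≤length-K′ = begin
          g                       ≡⟨ growth-length growth ⟨
          ∑ (⟦_⟧ ∘ member K)      ≤⟨ ∑-mono incl ⟩
          ∑ (⟦_⟧ ∘ member K′)     ≡⟨ growth-length grK′ ⟩
          length K′               ∎
          where
          open ≤-Reasoning
          incl : ∀ X → ⟦ member K X ⟧ ≤ ⟦ member K′ X ⟧
          incl X with member K X in eq
          ... | false = z≤n
          ... | true = ≤-reflexive (≡-sym (cong ⟦_⟧ (∈-member (K⊆K′ X (member-∈ eq)))))

        -- Placing `w` shifts vertices only inside `L`, so the chain through `K′`, now rooted at the
        -- small class `V`, survives and replaces `W ∷ L`.
        movable : ∀ X → X ∈ L → Free f w X → Improvement (W ∷ L)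
        movable X X∈L free = improved (place f₁ proper₁ balanced₁ chainL₁ w f₁w X X∈L (Free-⊆ {f} (f₁⊆f (L≢W X∈L)) free))
          where
          improved : Placed f₁ L w → Improvement (W ∷ L)
          improved P = record
            { new = new ; newChain = K′ ; proper = proper ; balanced = balanced ; domain = domain₃ P
            ; chain = transfer agree (λ i i∈K′ → K∉L (K′⊆K i i∈K′)) chainK₁
            ; longer = ≤-trans (≤-trans (s≤s chain≤c) c<g) g≤length-K′ }
            where open Placed P

        module _ (stuck : ∀ X → X ∈ L → ¬ Free f w X) {z : Fin n} {U : Fin r} (fz : f z ≡ just U) (U∈K : U ∈ K)
                 (wz : adj G w z ≡ true) (z-solo : hits z W ≡ 1) (y≢z : y ≢ z) (yz : adj G y z ≡ false) where

          private
            W∉K′ : W ∉ K′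
            W∉K′ W∈K′ = K≢W (K′⊆K W W∈K′) refl

            L∉K′ : ∀ {X} → X ∈ L → X ∉ K′
            L∉K′ X∈L X∈K′ = K∉L (K′⊆K _ X∈K′) X∈L

            -- Placing `w` shifts vertices only inside `K′`, so the chain `W ∷ L` survives and gains
            -- the class that now contains `z`.
            improved : Placed f₁ K′ w → Improvement (W ∷ L)
            improved P = record
              { new = new ; newChain = proj₁ z-colored ∷ W ∷ L ; proper = proper ; balanced = balanced ; domain = domain₃ P
              ; chain = grow (U₃∉ z-colored) (inj₂ (W , here refl , z , proj₂ z-colored , free-z)) (grow W∉L (W-why₃ W-why)
                  (transfer agree (λ i → L∉K′) chainL₁))
              ; longer = ≤-refl }
              where
              open Placed P
              W-why₃ : Small f W ⊎ (∃ λ X → X ∈ L × Arc f W X) → Small new W ⊎ (∃ λ X → X ∈ L × Arc new W X)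
              W-why₃ (inj₁ small) = inj₁ (trans (size-cong new f₁ (λ v → proj₁ (agree W W∉K′ v)) (λ v → proj₂ (agree W W∉K′ v))) (trans size₁-W small))
              -- By `stuck` the witness `u` is not `w`, so it is still in `W`.
              W-why₃ (inj₂ (X , X∈L , u , fu , u-free)) = inj₂ (X , X∈L , u ,
                proj₂ (agree W W∉K′ u) (f₁-W′ u fu λ { refl → stuck X X∈L u-free }) ,
                Free-⊆ {f} (λ v e → f₁⊆f (L≢W X∈L) v (proj₁ (agree X (L∉K′ X∈L) v) e)) u-free)
              z-colored : ∃ λ U₃ → new z ≡ just U₃
              z-colored with new z | trans (domain₃ P z) (cong is-just fz)
              ... | just U₃ | _ = U₃ , refl
              -- The shift may have moved `z`, but only among the classes of `K′`.
              U₃∉ : ((U₃ , _) : ∃ λ U₃ → new z ≡ just U₃) → U₃ ∉ W ∷ L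
              U₃∉ (U₃ , fz₃) U₃∈ = K′∌U₃ (subst (_∈ K′) (just-injective (trans (≡-sym (f⊆f₁ (K≢W U∈K) z (y≢z ∘ ≡-sym) fz)) (proj₁ (agree U₃ K′∌U₃ z) fz₃))) (K⊆K′ U U∈K))
                where
                K′∌U₃ : U₃ ∉ K′
                K′∌U₃ U₃∈K′ = outside U₃ (K′⊆K U₃ U₃∈K′) U₃∈
              -- In the old `W` only `w` was adjacent to `z`, and it has left; the newcomer `y` is
              -- not adjacent to `z`.
              free-z : Free new z W
              free-z v e with f₁-W v (proj₁ (agree W W∉K′ v) e)
              ... | inj₁ refl = trans (sym G z y) yz
              ... | inj₂ (v≢w , fv) = solo-unique z-solo wz fv v≢w

          nonadjacent : ∀ V₀ → V₀ ∈ K → Free f₁ w V₀ → Improvement (W ∷ L)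
          nonadjacent V₀ V₀∈K free = improved (place f₁ proper₁ balanced₁ chainK₁ w f₁w V₀ (K⊆K′ V₀ V₀∈K) free)

      improve-movable : ∀ X → X ∈ L → Free f w X → Improvement (W ∷ L)
      improve-movable = let (_ , gr , to , from) = reroot Γ-sym Γ? growth closed V V∈K in movable gr to from

      improve-nonadjacent : (∀ X → X ∈ L → ¬ Free f w X) →
        ∀ {z U} → f z ≡ just U → U ∈ K → adj G w z ≡ true → hits z W ≡ 1 → y ≢ z → adj G y z ≡ false →
        ∀ V₀ → V₀ ∈ K → Free f₁ w V₀ → Improvement (W ∷ L)
      improve-nonadjacent = let (_ , gr , to , from) = reroot Γ-sym Γ? growth closed V V∈K in nonadjacent gr to from

    S-inv : ∀ v {y} → S v y ≡ true → ∃ λ V → f y ≡ just V × V ∈ K × adj G v y ≡ true × hits y W ≡ 1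
    S-inv v {y} e =
      let (in-K , e′) = ∧-true {within inK y} e
          (vy , y-solo) = ∧-true {adj G v y} e′
          (V , fy , eV) = within-just inK in-K
      in V , fy , member-∈ eV , vy , ≡ᵇ-true y-solo

    module Heavy {w : Fin n} (fw : f w ≡ just W) (heavy : 2 * g ≤ weight w) where

      H s : ℕ
      H = degIn (within inK) w
      s = ∑ (⟦_⟧ ∘ S w)

      H≤ : H ≤ c + g
      H≤ = ≤-trans (degIn≤degree (within inK) w) (≤-trans (Δ≤r w) (≤-reflexive (≡-sym c+g≡r)))

      2g≤H+s : 2 * g ≤ H + s
      2g≤H+s = ≤-trans heavy (≤-reflexive (weight≡ w))

      -- `w` has at most `r = c + g` neighbours, so a weight of `2g` needs at least `g - c` solo
      -- ones.
      g≤s+c : g ≤ s + c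
      g≤s+c = +-cancelˡ-≤ g _ _ (begin
        g + g         ≡⟨ cong (g +_) (+-identityʳ g) ⟨
        2 * g         ≤⟨ 2g≤H+s ⟩
        H + s         ≤⟨ +-monoˡ-≤ s H≤ ⟩
        c + g + s     ≡⟨ lem c g s ⟩
        g + (s + c)   ∎)
        where
        open ≤-Reasoning
        lem : ∀ c g s → c + g + s ≡ g + (s + c)
        lem = solve-∀

      S-nonempty : ∃ λ y → S w y ≡ true
      S-nonempty with any? (λ y → S w y Data.Bool.≟ true)
      ... | yes p = p
      ... | no ¬p = contradiction (≤-trans g≤s+c (≤-reflexive (cong (_+ c) (∑-zero λ y → cong ⟦_⟧ (≡false λ e → ¬p (y , e)))))) (<⇒≱ c<g)

      module _ (stuck : ∀ X → X ∈ L → ¬ Free f w X) where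

        -- `target` says that after a solo neighbour `y` of `w` in a class of `M` has moved to `W`,
        -- some class of `K` can receive `w`. Two choices of `M` occur: all of `K` if `w` misses a
        -- class of `K`, otherwise the classes in which `w` has a single neighbour.
        module _ (M : Fin r → Bool) (M⊆K : ∀ V → M V ≡ true → V ∈ K)
          (target : ∀ {y V} (fy : f y ≡ just V) (V∈K : V ∈ K) (wy : adj G w y ≡ true) (y-solo : hits y W ≡ 1) →
            M V ≡ true → ∃ λ V₀ → V₀ ∈ K × Free (Rotate.f₁ fw fy V∈K wy y-solo) w V₀)
          (many : g ≤ ∑ (λ y → ⟦ within M y ∧ soloAdj w y ⟧) + 3 * c) where

          D : Fin n → Bool
          D y = within M y ∧ soloAdj w y

          D⊆S : ∀ y → D y ≡ true → S w y ≡ true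
          D⊆S y e =
            let (in-M , e′) = ∧-true {within M y} e
                (V , fy , eV) = within-just M in-M
            in cong₂ _∧_ (just-within inK fy (∈-member (M⊆K V eV))) e′

          nonadjacentPair? : Dec (∃ λ y → ∃ λ z → D y ≡ true × S w z ≡ true × y ≢ z × adj G y z ≡ false)
          nonadjacentPair? = any? λ y → any? λ z →
            (D y Data.Bool.≟ true) ×-dec (S w z Data.Bool.≟ true) ×-dec ¬? (y ≟ z) ×-dec (adj G y z Data.Bool.≟ false)

          useNonadjacent : (∃ λ y → ∃ λ z → D y ≡ true × S w z ≡ true × y ≢ z × adj G y z ≡ false) → Improvement (W ∷ L)
          useNonadjacent (y , z , Dy , Sz , y≢z , yz) =
            let (V , fy , V∈K , wy , y-solo) = S-inv w (D⊆S y Dy)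
                (U , fz , U∈K , wz , z-solo) = S-inv w Sz
                (V′ , fy′ , MV′) = within-just M (proj₁ (∧-true {within M y} Dy))
                (V₀ , V₀∈K , free) = target fy V∈K wy y-solo (subst (λ i → M i ≡ true) (just-injective (trans (≡-sym fy′) fy)) MV′)
            in Rotate.improve-nonadjacent fw fy V∈K wy y-solo stuck fz U∈K wz z-solo y≢z yz V₀ V₀∈K free

          -- With no such pair, `D` dominates `S w`, and the subgraph induced by `S w` and `w` is
          -- too dense.
          impossible : ¬ (∃ λ y → ∃ λ z → D y ≡ true × S w z ≡ true × y ≢ z × adj G y z ≡ false) → ⊥
          impossible ¬pair = density-contradiction {Y = ∣D∣} {e = ∣S∖D∣} N≡ M≡ 0<A
            (ratio 0<g (<⇒≤ c<g) (≤-trans cg≤ (≤-reflexive (cong (λ k → h * (k * k)) (≡-sym c+g≡r)))))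
            (≤-trans (s≤s z≤n) chain≤c) ∣S∣≡ many g≤s+c
            (≤-trans (dominated-bound {p} {q} {r} {N} {h} 0<q sparse Nd≤hr) (≤-reflexive (cong (λ k → 2 * h * (k * suc s)) (≡-sym c+g≡r))))
            where
            open Threshold τ
            w∉S : S w w ≡ false
            w∉S = ≡false λ e → let (V , fw′ , V∈K , _) = S-inv w e in K≢W V∈K (just-injective (trans (≡-sym fw′) fw))
            open Dominated G w (S w) D w∉S (λ y e → proj₁ (proj₂ (proj₂ (proj₂ (S-inv w e))))) D⊆S
              (λ y z Dy Sz y≢z → ¬false⇒true λ e → ¬pair (y , z , Dy , Sz , y≢z , e))

          conclude : Improvement (W ∷ L)
          conclude with nonadjacentPair?
          ... | yes pair = useNonadjacent pair
          ... | no ¬pair = ⊥-elim (impossible ¬pair)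

        improve-missing : ∀ V₀ → V₀ ∈ K → Free f w V₀ → Improvement (W ∷ L)
        improve-missing V₀ V₀∈K free = conclude inK (λ V → member-∈)
          (λ fy V∈K wy y-solo _ → V₀ , V₀∈K , Free-⊆ {f} (Rotate.f₁⊆f fw fy V∈K wy y-solo (K≢W V₀∈K)) free)
          -- For this `M` the set `D` is `S w` itself.
          (≤-trans g≤s+c (+-monoʳ-≤ s (m≤m+n c _)))

        module _ (hitsAll : ∀ V → V ∈ K → ¬ Free f w V) where

          single : Fin r → Bool
          single V = inK V ∧ (hits w V ≡ᵇ 1)

          soloHits : Fin r → ℕ
          soloHits V = ∑ λ y → ⟦ cl f V y ⟧ * ⟦ soloAdj w y ⟧

          soloHits≤hits : ∀ V → soloHits V ≤ hits w V
          soloHits≤hits V = ∑-mono λ y → *-monoʳ-≤ ⟦ cl f V y ⟧ (lem (adj G w y) (solo y))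
            where
            lem : ∀ a b → ⟦ a ∧ b ⟧ ≤ ⟦ a ⟧
            lem false _ = z≤n
            lem true b = ⟦⟧≤1 b

          ∑-soloHits : ∀ M → ∑ (λ y → ⟦ within M y ∧ soloAdj w y ⟧) ≡ ∑ λ V → ⟦ M V ⟧ * soloHits V
          ∑-soloHits M = trans (∑-cong λ y → ⟦∧⟧ (within M y) (soloAdj w y)) (∑-within M (λ y → ⟦ soloAdj w y ⟧))

          d : ℕ
          d = ∑ (λ y → ⟦ within single y ∧ soloAdj w y ⟧)

          -- Compared class by class, with `k = hits w V ≥ 1` and at most `k` solo neighbours in
          -- `V`: for `k = 1` the class is single and equality holds; for `k ≥ 2` the term `2k`
          -- alone covers 2 plus the solo ones.
          2g+s≤d+2H : 2 * g + s ≤ d + 2 * H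
          2g+s≤d+2H = begin
            2 * g + s
              ≡⟨ cong₂ (λ a b → 2 * a + b) (≡-sym (growth-length growth)) (∑-soloHits inK) ⟩
            2 * ∑ (⟦_⟧ ∘ inK) + ∑ (λ V → ⟦ inK V ⟧ * soloHits V)
              ≡⟨ cong (_+ ∑ (λ V → ⟦ inK V ⟧ * soloHits V)) (*-∑ 2 (⟦_⟧ ∘ inK)) ⟩
            ∑ (λ V → 2 * ⟦ inK V ⟧) + ∑ (λ V → ⟦ inK V ⟧ * soloHits V)
              ≡⟨ ∑-+ (λ V → 2 * ⟦ inK V ⟧) (λ V → ⟦ inK V ⟧ * soloHits V) ⟨
            ∑ (λ V → 2 * ⟦ inK V ⟧ + ⟦ inK V ⟧ * soloHits V)
              ≤⟨ ∑-mono bound ⟩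
            ∑ (λ V → ⟦ single V ⟧ * soloHits V + 2 * (⟦ inK V ⟧ * hits w V))
              ≡⟨ ∑-+ (λ V → ⟦ single V ⟧ * soloHits V) (λ V → 2 * (⟦ inK V ⟧ * hits w V)) ⟩
            ∑ (λ V → ⟦ single V ⟧ * soloHits V) + ∑ (λ V → 2 * (⟦ inK V ⟧ * hits w V))
              ≡⟨ cong₂ _+_ (∑-soloHits single) (trans (cong (2 *_) (∑-within inK (α w))) (*-∑ 2 _)) ⟨
            d + 2 * H ∎
            where
            open ≤-Reasoning
            lem : ∀ b k s → (b ≡ true → 1 ≤ k) → s ≤ k → 2 * ⟦ b ⟧ + ⟦ b ⟧ * s ≤ ⟦ b ∧ (k ≡ᵇ 1) ⟧ * s + 2 * (⟦ b ⟧ * k)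
            lem false k s _ _ = z≤n
            lem true zero s 1≤k _ = contradiction (1≤k refl) λ ()
            lem true (suc zero) s _ _ = ≤-reflexive (+-comm 2 (1 * s))
            lem true (suc (suc k)) s _ s≤k = +-mono-≤ (≤-trans (s≤s (s≤s z≤n)) (≤-reflexive (≡-sym (+-identityʳ (2 + k)))))
              (≤-trans (≤-reflexive (+-identityʳ s)) (≤-trans s≤k (≤-reflexive (≡-sym (trans (+-identityʳ _) (+-identityʳ (2 + k)))))))
            bound : ∀ V → 2 * ⟦ inK V ⟧ + ⟦ inK V ⟧ * soloHits V ≤ ⟦ single V ⟧ * soloHits V + 2 * (⟦ inK V ⟧ * hits w V)
            bound V = lem (inK V) (hits w V) (soloHits V) (λ e → ¬Free⇒hits (hitsAll V (member-∈ e))) (soloHits≤hits V)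

          -- Adding `2g ≤ H + s` cancels `s` and leaves `4g ≤ d + 3H`, where `H ≤ c + g`.
          many : g ≤ d + 3 * c
          many = +-cancelˡ-≤ (3 * g + s) _ _ (begin
            3 * g + s + g             ≡⟨ lem₁ g s ⟩
            2 * g + s + 2 * g         ≤⟨ +-mono-≤ 2g+s≤d+2H 2g≤H+s ⟩
            d + 2 * H + (H + s)       ≡⟨ lem₂ d H s ⟩
            d + s + 3 * H             ≤⟨ +-monoʳ-≤ (d + s) (*-monoʳ-≤ 3 H≤) ⟩
            d + s + 3 * (c + g)       ≡⟨ lem₃ d s c g ⟩
            3 * g + s + (d + 3 * c)   ∎)
            where
            open ≤-Reasoning
            lem₁ : ∀ g s → 3 * g + s + g ≡ 2 * g + s + 2 * g
            lem₁ = solve-∀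
            lem₂ : ∀ d H s → d + 2 * H + (H + s) ≡ d + s + 3 * H
            lem₂ = solve-∀
            lem₃ : ∀ d s c g → d + s + 3 * (c + g) ≡ 3 * g + s + (d + 3 * c)
            lem₃ = solve-∀

          improve-single : Improvement (W ∷ L)
          improve-single = conclude single (λ V e → member-∈ (proj₁ (∧-true {inK V} e))) target many
            where
            target : ∀ {y V} (fy : f y ≡ just V) (V∈K : V ∈ K) (wy : adj G w y ≡ true) (y-solo : hits y W ≡ 1) →
              single V ≡ true → ∃ λ V₀ → V₀ ∈ K × Free (Rotate.f₁ fw fy V∈K wy y-solo) w V₀
            -- The only neighbour of `w` in `V` was `y`, which is now in `W`.
            target {y} {V} fy V∈K wy y-solo e = V , V∈K , λ v f₁v → ≡false λ wv →
              V≢W (just-injective (trans (≡-sym f₁v) (subst (λ u → f₁ u ≡ just W)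
                (hits≡1⇒unique (≡ᵇ-true (proj₂ (∧-true {inK V} e))) fy wy (f₁⊆f V≢W v f₁v) wv) (set-same f₀ y (just W)))))
              where open Rotate fw fy V∈K wy y-solo

      improve-heavy : Improvement (W ∷ L)
      improve-heavy with any? (λ X → (X ∈? L) ×-dec Free? f w X) | any? (λ V → (V ∈? K) ×-dec Free? f w V)
        where open DecMembership (_≟_ {r}) using (_∈?_)
      ... | yes (X , X∈L , free) | _ =
        let (y , Sy) = S-nonempty
            (V , fy , V∈K , wy , y-solo) = S-inv w Sy
        in Rotate.improve-movable fw fy V∈K wy y-solo X X∈L free
      ... | no stuck | yes (V₀ , V₀∈K , free) = improve-missing (λ X X∈L free → stuck (X , X∈L , free)) V₀ V₀∈K free
      ... | no stuck | no hit = improve-single (λ X X∈L free → stuck (X , X∈L , free)) (λ V V∈K free → hit (V , V∈K , free))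

    improve : Improvement (W ∷ L)
    improve = let (w , fw , heavy) = ∃-heavyVertex in Heavy.improve-heavy (cl-true f fw) heavy

-- Inserting the vertices one at a time

module Insertion {n : ℕ} (G : Graph n) {p q r N h : ℕ} (τ : Threshold N h) (0<p : 0 < p) (0<q : 0 < q)
  (sparse : (H : Subgraph G) → q * ‖ H ‖ₑ ≤ p * ∣ H ∣ᵥ) (Nd≤hr : N * p ≤ h * (q * r))
  (Δ≤r : ∀ v → degree G v ≤ r) where

  open Sparse G

  record EquitableOn (U : Fin n → Bool) : Set where
    field
      t        : ℕ
      f        : PartialColoring n r
      proper   : ∀ u v i → f u ≡ just i → f v ≡ just i → adj G u v ≡ false
      balanced : Balanced t f
      domain   : ∀ v → is-just (f v) ≡ U v

  without : (Fin n → Bool) → Fin n → Fin n → Bool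
  without U x v = if ⌊ v ≟ x ⌋ then false else U v

  without-other : ∀ U x v → v ≢ x → without U x v ≡ U v
  without-other U x v v≢x = cong (λ b → if b then false else U v) (≟-false v≢x)

  without-self : ∀ U x → without U x x ≡ false
  without-self U x = cong (λ b → if b then false else U x) (≟-refl x)

  without≤ : ∀ U x v → ⟦ without U x v ⟧ ≤ ⟦ U v ⟧
  without≤ U x v with ⌊ v ≟ x ⌋
  ... | true = z≤n
  ... | false = ≤-refl

  degIn-mono : ∀ {P Q} → (∀ v → ⟦ P v ⟧ ≤ ⟦ Q v ⟧) → ∀ u → degIn P u ≤ degIn Q u
  degIn-mono le u = ∑-mono λ v → *-monoˡ-≤ (α u v) (le v)

  module _ (U : Fin n → Bool) (x : Fin n) (x∈U : U x ≡ true) (x-low : q * degIn U x ≤ 2 * p) (t : ℕ) where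

    open Moves G {r} t
    open DecMembership (_≟_ {r}) using (_∈?_)

    -- Each round places `x` or lengthens the chain. A chain has at most `r` members, so the fuel
    -- `k` cannot run out.
    insertLoop : ∀ k f {L} → Proper f → Balanced t f → (∀ v → is-just (f v) ≡ without U x v) →
      Chain f L → 0 < length L → r < length L + k → EquitableOn U
    insertLoop zero f {L} pr bal dom ch 0<L r< = contradiction (growth-length≤ ch) (<⇒≱ (≤-trans r< (≤-reflexive (+-identityʳ _))))
    insertLoop (suc k) f {L} pr bal dom ch 0<L r< = fromSaturated (saturate (Small? f) (Arc? f) ch)
      where
      open Improve G τ t 0<p 0<q sparse Nd≤hr Δ≤r f using (Improvement; improve)
      open Component G {N = N} {h = h} t (Threshold.6h<N τ) 0<p 0<q sparse Nd≤hr f using (bigComponent)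

      fx : f x ≡ nothing
      fx with f x | trans (dom x) (without-self U x)
      ... | nothing | _ = refl

      f-low : q * degIn (λ v → is-just (f v)) x ≤ 2 * p
      f-low = ≤-trans (*-monoʳ-≤ q (degIn-mono (λ v → ≤-trans (≤-reflexive (cong ⟦_⟧ (dom v))) (without≤ U x v)) x)) x-low

      finish : ∀ {M} → Placed f M x → EquitableOn U
      finish P = record { t = t ; f = new ; proper = proper ; balanced = balanced ; domain = domain′ }
        where
        open Placed P
        domain′ : ∀ v → is-just (new v) ≡ U v
        domain′ v with v ≟ x
        ... | yes refl = trans colored (≡-sym x∈U)
        ... | no v≢x = trans (domain v v≢x) (trans (dom v) (without-other U x v v≢x))

      continue : ∀ {M} → length L ≤ length M → Improvement M → EquitableOn U
      continue L≤M I = insertLoop k new proper balanced (λ v → trans (domain v) (dom v)) chain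
        (≤-trans 0<L (≤-trans L≤M (<⇒≤ longer)))
        (≤-trans r< (≤-trans (≤-reflexive (+-suc _ k)) (+-monoˡ-≤ k (≤-trans (s≤s L≤M) longer))))
        where open Improvement I

      fromSaturated : (∃ λ M → Chain f M × Saturated (Small f) (Arc f) M × length L ≤ length M) → EquitableOn U
      fromSaturated (M , ch′ , sat , L≤M) with any? (λ V → (V ∈? M) ×-dec Free? f x V)
      ... | yes (V , V∈M , free) = finish (place f pr bal ch′ x fx V V∈M free)
      fromSaturated ([] , ch′ , sat , L≤M) | no _ = contradiction (≤-trans 0<L L≤M) λ ()
      fromSaturated (W ∷ M , ch′@(grow W∉M why chM) , sat , L≤M) | no ¬free = continue L≤M
        (improve pr bal W∉M why chM sat (bigComponent bal ch′ sat x (λ V V∈M free → ¬free (V , V∈M , free)) f-low))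

  insert : Fin r → ∀ U x → U x ≡ true → q * degIn U x ≤ 2 * p → EquitableOn (without U x) → EquitableOn U
  insert V₀ U x x∈U x-low E = fromSmall (any? (λ V → size f V Data.Nat.≟ t))
    where
    open EquitableOn E
    start : ∀ t′ → Balanced t′ f → ∀ V → size f V ≡ t′ → EquitableOn U
    start t′ bal V small = insertLoop U x x∈U x-low t′ r f {V ∷ []} proper bal domain (grow (λ ()) (inj₁ small) []) (s≤s z≤n) ≤-refl
    fromSmall : Dec (∃ λ V → size f V ≡ t) → EquitableOn U
    fromSmall (yes (V , small)) = start t balanced V small
    -- All classes have `t + 1` vertices; with `t` raised by one they are all small, and `V₀` can
    -- start the chain.
    fromSmall (no ¬small) = start (suc t) (λ V → inj₁ (full V)) V₀ (full V₀)
      where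
      full : ∀ V → size f V ≡ suc t
      full V with balanced V
      ... | inj₁ e = contradiction (V , e) ¬small
      ... | inj₂ e = e

  equitableOn : Fin r → ∀ m U → ∑ (⟦_⟧ ∘ U) ≡ m → EquitableOn U
  equitableOn V₀ zero U ∑U = record
    { t = 0
    ; f = λ _ → nothing
    ; proper = λ _ _ _ ()
    ; balanced = λ i → inj₁ (∑-zero λ v → cong ⟦_⟧ (false-cl (λ _ → nothing) {i} {v} λ ()))
    ; domain = λ v → ≡-sym (≡false λ e → contradiction (≤-trans (∑-pos U v e) (≤-reflexive ∑U)) λ ())
    }
  equitableOn V₀ (suc m) U ∑U =
    let (x , x∈U , x-low) = ∃-lowDegree {p} {q} sparse U (≤-trans (s≤s z≤n) (≤-reflexive (≡-sym ∑U)))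
    in insert V₀ U x x∈U x-low (equitableOn V₀ m (without U x) (remove x x∈U))
    where
    remove : ∀ x → U x ≡ true → ∑ (⟦_⟧ ∘ without U x) ≡ m
    remove x x∈U = suc-injective (begin
      1 + ∑ (⟦_⟧ ∘ without U x)                  ≡⟨ cong (λ b → ⟦ b ⟧ + ∑ (⟦_⟧ ∘ without U x)) x∈U ⟨
      ⟦ U x ⟧ + ∑ (⟦_⟧ ∘ without U x)            ≡⟨ ∑-update x (λ v v≢x → cong ⟦_⟧ (without-other U x v v≢x)) ⟩
      ⟦ without U x x ⟧ + ∑ (⟦_⟧ ∘ U)            ≡⟨ cong (λ b → ⟦ b ⟧ + ∑ (⟦_⟧ ∘ U)) (without-self U x) ⟩
      ∑ (⟦_⟧ ∘ U)                                ≡⟨ ∑U ⟩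
      suc m                                      ∎)
      where open ≡-Reasoning

  total⇒coloring : EquitableOn (λ _ → true) → EquitableColoring G r
  total⇒coloring E = record
    { color = color
    ; proper = λ u v uv e → true≢false uv (proper u v (color u) (f-color u) (trans (f-color v) (cong just (≡-sym e))))
    ; equit = λ a b → subst₂ (λ k l → k ≤ l + 1) (≡-sym (class-size a)) (≡-sym (class-size b)) (close (balanced a) (balanced b))
    }
    where
    open EquitableOn E
    colored : ∀ v → ∃ λ i → f v ≡ just i
    colored v with f v | domain v
    ... | just i | _ = i , refl
    color : Fin n → Fin r
    color v = proj₁ (colored v)
    f-color : ∀ v → f v ≡ just (color v)
    f-color v = proj₂ (colored v)
    class-size : ∀ a → count (λ v → ⌊ color v ≟ a ⌋) ≡ size f a
    class-size a = trans (count≡∑ _) (∑-cong λ v → cong ⟦_⟧ (same v))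
      where
      same : ∀ v → ⌊ color v ≟ a ⌋ ≡ cl f a v
      same v with color v ≟ a
      ... | yes e = ≡-sym (true-cl f (trans (f-color v) (cong just e)))
      ... | no ¬e = ≡-sym (false-cl f λ fv → ¬e (just-injective (trans (≡-sym (f-color v)) fv)))
    close : ∀ {k l} → k ≡ t ⊎ k ≡ suc t → l ≡ t ⊎ l ≡ suc t → k ≤ l + 1
    close (inj₁ refl) (inj₁ refl) = m≤m+n t 1
    close (inj₁ refl) (inj₂ refl) = ≤-trans (n≤1+n t) (m≤m+n (suc t) 1)
    close (inj₂ refl) (inj₁ refl) = ≤-reflexive (+-comm 1 t)
    close (inj₂ refl) (inj₂ refl) = m≤m+n (suc t) 1

  equitableColoring : Fin r → EquitableColoring G r
  equitableColoring V₀ = total⇒coloring (equitableOn V₀ _ (λ _ → true) refl)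

theorem2 : (n : ℕ) (G : Graph n) (p q : ℕ) →
    0 < p → 0 < q →
    ((H : Subgraph G) → q * ‖ H ‖ₑ ≤ p * ∣ H ∣ᵥ) →
    621 * p ≤ 100 * (q * maxDegree G) →
    (r : ℕ) → maxDegree G ≤ r → EquitableColoring G r
theorem2 n G p q 0<p 0<q sparse 6d≤Δ zero Δ≤r =
  -- No colours force maximum degree 0, which contradicts `6.21 d ≤ Δ` for positive `d`.
  contradiction (≤-trans (*-monoʳ-≤ 621 0<p) (≤-trans 6d≤Δ (≤-reflexive 100qΔ≡0))) λ ()
  where
  100qΔ≡0 : 100 * (q * maxDegree G) ≡ 0
  100qΔ≡0 = trans (cong (λ k → 100 * (q * k)) (n≤0⇒n≡0 Δ≤r)) (cong (100 *_) (*-zeroʳ q))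
theorem2 n G p q 0<p 0<q sparse 6d≤Δ (suc r) Δ≤r =
  Insertion.equitableColoring G threshold 0<p 0<q sparse
    (≤-trans 6d≤Δ (*-monoʳ-≤ 100 (*-monoʳ-≤ q Δ≤r)))
    (λ v → ≤-trans (Sparse.degree≤maxDegree G v) Δ≤r) zero
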